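{- Let $\Pi$ be an LCL problem in rooted regular trees (without inputs). Then $\Pi$ has locality $\Omega(\log n)$ in the LOCAL model if and only if it has locality $\Omega(\log n)$ in the online-LOCAL model.
   Context: An LCL problem in rooted trees is a triple $\Pi=(\delta,\Gamma,C)$ where $\delta\ge 1$ is the number of allowed children, $\Gamma$ is a finite set of output labels, and $C\subseteq\Gamma^{\delta+1}$ is a set of allowed configurations $(a : b_1 b_2\dots b_\delta)$, meaning that a node labeled $a$ may have children labeled $b_1,\dots,b_\delta$ in some order. The inputs are rooted trees in which every non-leaf node has exactly $\delta$ children (no input labels); a labeling is feasible if every node with $\delta$ children, together with its children, forms an allowed configuration. $n$ is the number of nodes, known to algorithms; $B(v,T)$ is the set of nodes within distance $T$ of $v$. LOCAL model with locality $T$: the adversary assigns unique identifiers from $\{1,\dots,\mathrm{poly}(n)\}$; each node outputs a function of its radius-$T$ neighborhood. Online-LOCAL model with locality $T$: the adversary chooses an ordering $v_1,\dots,v_n$ of the nodes; with $G_i = G\bigl[\bigcup_{j\le i}B(v_j,T)\bigr]$, when $v_i$ is presented the algorithm, with unbounded memory, must irrevocably output the label of $v_i$ based on $v_1,\dots,v_i$ and $G_i$. An algorithm solves $\Pi$ if for every input and every adversarial choice the output is feasible. The locality of $\Pi$ in a model is the pointwise smallest function $T(n)$ such that some algorithm in that model solves $\Pi$ with locality at most $T$. -}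

module Defs where

open import Data.Nat using (ℕ; zero; suc; _≤_; _*_; _^_)
open import Data.Nat.Logarithm using (⌊log₂_⌋)
open import Data.Fin using (Fin)
open import Data.Maybe using (Maybe; just; nothing)
open import Data.Vec using (Vec; tabulate)
open import Data.List using (List)
open import Data.List.Membership.Propositional using (_∈_)
open import Data.Product using (Σ; ∃; _×_; _,_)
open import Data.Sum using (_⊎_)
open import Relation.Nullary using (¬_)
open import Relation.Binary.PropositionalEquality using (_≡_)
open import Function.Bundles using (_⇔_; _↔_; Inverse)

-- LCL problems in rooted regular trees:  Π = (δ, Γ, C)
-- Γ = Fin g (a finite set of g labels); C is a finite list of allowed
-- configurations (a : b₁ … b_δ).

record LCL : Set where
  field
    δ      : ℕ
    δ≥1    : 1 ≤ δ
    g      : ℕ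
    C      : List (Fin g × Vec (Fin g) δ)

Injective : {A B : Set} → (A → B) → Set
Injective f = ∀ {x y} → f x ≡ f y → x ≡ y

module _ {n : ℕ} (parent : Fin n → Maybe (Fin n)) where

  ancestor : ℕ → Fin n → Maybe (Fin n)
  ancestor zero    v = just v
  ancestor (suc k) v with parent v
  ... | nothing = nothing
  ... | just w  = ancestor k w

  IsLeaf : Fin n → Set
  IsLeaf v = ∀ u → ¬ (parent u ≡ just v)

  ChildEnum : ℕ → Fin n → Set
  ChildEnum δ v = Σ (Fin δ → Fin n) λ e →
      Injective e
    × (∀ i → parent (e i) ≡ just v)
    × (∀ u → parent u ≡ just v → ∃ λ i → e i ≡ u)

record RTree (δ n : ℕ) : Set where
  field
    parent   : Fin n → Maybe (Fin n)
    root     : Fin n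
    root-top : parent root ≡ nothing
    uniqueRt : ∀ v → parent v ≡ nothing → v ≡ root
    acyclic  : ∀ v → ∃ λ k → ancestor parent k v ≡ nothing
    regular  : ∀ v → IsLeaf parent v ⊎ ChildEnum parent δ v

open RTree public

Adj : ∀ {δ n} → RTree δ n → Fin n → Fin n → Set
Adj t u w = (parent t u ≡ just w) ⊎ (parent t w ≡ just u)

data Reach {δ n : ℕ} (t : RTree δ n) : ℕ → Fin n → Fin n → Set where
  here : ∀ {k u} → Reach t k u u
  step : ∀ {k u w x} → Adj t u w → Reach t k w x → Reach t (suc k) u x

InBall : ∀ {δ n} → RTree δ n → ℕ → Fin n → Fin n → Set
InBall t T v u = Reach t T v u

Feasible : (Π : LCL) → ∀ {n} → RTree (LCL.δ Π) n → (Fin n → Fin (LCL.g Π)) → Set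
Feasible Π t ℓ = ∀ v → ChildEnum (parent t) (LCL.δ Π) v →
  Σ (ChildEnum (parent t) (LCL.δ Π) v) λ { (e , _) →
      (ℓ v , tabulate (λ i → ℓ (e i))) ∈ LCL.C Π }

module _ {δ n : ℕ} (t t' : RTree δ n) where

  ViewIso : (R R' : Fin n → Set) → (π : Fin n ↔ Fin n) → Set
  ViewIso R R' π =
      (∀ u → R u ⇔ R' (Inverse.to π u))
    × (∀ u w → R u → R w →
         (parent t u ≡ just w) ⇔ (parent t' (Inverse.to π u) ≡ just (Inverse.to π w)))

-- LOCAL model.  Identifiers: injective maps into {1,…,n^c} (here Fin (n ^ c)).
-- A LOCAL algorithm (for a fixed, known n) maps (tree, ids, node) to a label;
-- it has locality T if the output of v depends only on the radius-T view of v
-- (induced subgraph on B(v,T) with its orientation and identifiers).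

IdAssign : ℕ → ℕ → Set
IdAssign c n = Σ (Fin n → Fin (n ^ c)) Injective

LocalAlg : ℕ → LCL → ℕ → Set
LocalAlg c Π n = RTree (LCL.δ Π) n → IdAssign c n → Fin n → Fin (LCL.g Π)

LocalView : ∀ {δ n c} (T : ℕ) → RTree δ n → IdAssign c n → Fin n →
            RTree δ n → IdAssign c n → Fin n → Set
LocalView T t (id , _) v t' (id' , _) v' =
  Σ (_ ↔ _) λ π →
      Inverse.to π v ≡ v'
    × ViewIso t t' (InBall t T v) (InBall t' T v') π
    × (∀ u → InBall t T v u → id' (Inverse.to π u) ≡ id u)

HasLocalityLOCAL : ∀ c Π n → ℕ → LocalAlg c Π n → Set
HasLocalityLOCAL c Π n T A =
  ∀ t ids v t' ids' v' → LocalView {c = c} T t ids v t' ids' v' →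
    A t ids v ≡ A t' ids' v'

SolvesLOCAL : (c : ℕ) → (Π : LCL) → (n T : ℕ) → Set
SolvesLOCAL c Π n T = Σ (LocalAlg c Π n) λ A →
    HasLocalityLOCAL c Π n T A
  × (∀ t ids → Feasible Π t (A t ids))

-- Online-LOCAL model.  The adversary's order is a permutation σ (σ i = v_{i+1}).
-- At step i the algorithm has seen v_1,…,v_i and G_i = G[⋃_{j≤i} B(v_j,T)];
-- an online algorithm maps (tree, order, step i) to the label of σ i, and it
-- has locality T if this output depends only on what is revealed at step i
-- (up to isomorphism, with the presented nodes matched in order).

Revealed : ∀ {δ n} → RTree δ n → ℕ → (Fin n ↔ Fin n) → Fin n → Fin n → Set
Revealed t T σ i u = ∃ λ j → (j Data.Fin.≤ i) × InBall t T (Inverse.to σ j) u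

OnlineAlg : LCL → ℕ → Set
OnlineAlg Π n = RTree (LCL.δ Π) n → (Fin n ↔ Fin n) → Fin n → Fin (LCL.g Π)

OnlineView : ∀ {δ n} (T : ℕ) → RTree δ n → (Fin n ↔ Fin n) →
             RTree δ n → (Fin n ↔ Fin n) → Fin n → Set
OnlineView T t σ t' σ' i =
  Σ (_ ↔ _) λ π →
      (∀ j → j Data.Fin.≤ i → Inverse.to π (Inverse.to σ j) ≡ Inverse.to σ' j)
    × ViewIso t t' (Revealed t T σ i) (Revealed t' T σ' i) π

HasLocalityOnline : ∀ Π n → ℕ → OnlineAlg Π n → Set
HasLocalityOnline Π n T A =
  ∀ t σ t' σ' i → OnlineView T t σ t' σ' i → A t σ i ≡ A t' σ' i

SolvesOnline : (Π : LCL) → (n T : ℕ) → Set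
SolvesOnline Π n T = Σ (OnlineAlg Π n) λ A →
    HasLocalityOnline Π n T A
  × (∀ t σ → Feasible Π t (λ v → A t σ (Inverse.from σ v)))

-- "Π has locality Ω(log n)" : there are constants k, n₀ such that for every
-- n ≥ n₀ for which n-node instances exist, every T admitting an algorithm
-- that solves Π on n-node instances satisfies ⌊log₂ n⌋ ≤ k·T
-- (i.e. the pointwise-smallest locality is ≥ (1/k) log n).

LocalityΩlog : (δ : ℕ) → (Solves : ℕ → ℕ → Set) → Set
LocalityΩlog δ Solves = ∃ λ k → ∃ λ n₀ → ∀ n → n₀ ≤ n → RTree δ n →
  ∀ T → Solves n T → ⌊log₂ n ⌋ ≤ k * T

{-# OPTIONS --safe #-}

-- From online-LOCAL lower bounds to LOCAL ones: an online algorithm simulates a LOCAL one by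
-- always giving the least label that is consistent with some identifier assignment.
--
-- From LOCAL to online-LOCAL: suppose an online algorithm beats log n / k.  Present it with g + 1
-- layers of subtrees that look alike; some layer receives only labels that also occur in another
-- layer.  Since the answers do not depend on where the subtrees are placed, the layer can
-- afterwards be put at depth ℓ below any node carrying one of its labels, for all D ≤ ℓ < 2D, and
-- the algorithm has to complete the tree in between.  The completed trees form a certificate.
-- Given a certificate, Cole–Vishkin colour reduction along the paths to the root and a greedy
-- ruling set cut every path into pieces of length between D and 2D, which are filled with the
-- trees of the certificate.  Two rounds of colour reduction already give locality
-- polyloglog n = o(log n), which contradicts the LOCAL lower bound.
module Submission where

open import Defs
open import Data.Bool using (Bool; true; false; _∨_; _∧_; not; if_then_else_)
open import Data.Bool.Properties using (T-≡; ∨-zeroʳ)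
open import Data.Empty using (⊥)
open import Data.Fin using (Fin; zero; suc; toℕ; fromℕ<; inject≤; combine; remQuot; finToFun; funToFin; splitAt; _↑ˡ_; _↑ʳ_)
open import Data.Fin.Permutation using (transpose; _∘ₚ_)
import Data.Fin.Permutation as Perm
open import Data.Fin.Permutation.Components using () renaming (transpose to swap)
import Data.Fin.Properties as Fin
open import Data.List using (List; []; _∷_; _++_; length; take; drop; allFin; cartesianProduct; cartesianProductWith)
open import Data.List.Membership.Propositional using (_∈_)
open import Data.List.Membership.Propositional.Properties using (∈-allFin; ∈-cartesianProduct⁺; ∈-cartesianProduct⁻; ∈-cartesianProductWith⁺; ∈-cartesianProductWith⁻)
open import Data.List.Properties using (length-++; take++drop≡id; length-take; length-drop; ∷-injective)
open import Data.List.Relation.Unary.Any using (here; there)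
open import Data.Maybe using (Maybe; just; nothing; maybe′)
import Data.Maybe as Maybe
open import Data.Maybe.Properties using (just-injective; ≡-dec)
open import Data.Nat using (ℕ; zero; suc; _+_; _*_; _^_; _∸_; _⊓_; _≤_; _<_; z≤n; s≤s; _≡ᵇ_; NonZero; >-nonZero; >-nonZero⁻¹)
open import Data.Nat.DivMod using (_/_; _%_; _mod_; m%n<n; m/n≤m; m≡m%n+[m/n]*n; [m+kn]%n≡m%n; m<n⇒m%n≡m)
open import Data.Nat.Divisibility using (divides; ∣⇒≤; ∣m+n∣m⇒∣n)
open import Data.Nat.Logarithm using (⌊log₂_⌋; ⌊log₂⌋-mono-≤; ⌊log₂[2^n]⌋≡n)
import Data.Nat.Properties as ℕ
open import Data.Nat.Solver using (module +-*-Solver)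
open import Data.Product using (Σ; ∃; _×_; _,_; proj₁; proj₂; uncurry)
open import Data.Sum using (_⊎_; inj₁; inj₂; [_,_]′)
open import Data.Unit using (⊤; tt)
open import Data.Vec using (tabulate)
open import Data.Vec.Properties using (tabulate-cong)
open import Function using (_∘_)
open import Function.Bundles using (_⇔_; _↔_; Inverse; Equivalence; mk⇔)
open import Function.Construct.Identity using (↔-id)
open import Function.Construct.Symmetry using (↔-sym)
open import Relation.Binary.PropositionalEquality
open import Relation.Nullary using (¬_; Dec; yes; no; does; contradiction)
open import Relation.Nullary.Decidable using (map′; does-⇔; ¬?; _×-dec_; _→-dec_)
open import Relation.Unary using (Decidable)

-- A certificate mentions neither `n` nor identifiers. One pair `(n, T)` at which the online
-- algorithm is too fast therefore refutes the LOCAL bound, possibly at an entirely different size.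
-- Clusters of the recurring layer are moved to become the bottom of a tree, so the node on top must
-- carry the same label in a layer that stays in place. With `g + 1` layers and `g` labels, not
-- every layer can own a private label. The labels at the bottom of a tree do not depend on the
-- label on top. Hence a node where two trees meet knows its label from its address in the upper
-- tree alone, and stacking trees creates no dependency chain towards the root. Everything is
-- computed from ancestors only: siblings share their proper ancestors, so they agree on where their
-- common tree ends. The range `D ≤ ℓ < 2D` is exactly the range of gaps in a maximal set of spacing
-- `D`.

-- Least witnesses and isomorphisms of views

least : ∀ {m} {P : Fin m → Set} → Decidable P → Maybe (Fin m)
least {zero}  P? = nothing
least {suc m} P? = if does (P? zero) then just zero else Maybe.map suc (least (P? ∘ suc))

-- Choices made by `least` depend only on which values satisfy the predicate, not on how it is
-- decided. This makes the choices of both algorithms functions of the view alone.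
least-cong : ∀ {m} {P Q : Fin m → Set} (P? : Decidable P) (Q? : Decidable Q) →
             (∀ x → P x ⇔ Q x) → least P? ≡ least Q?
least-cong {zero}  P? Q? eq = refl
least-cong {suc m} P? Q? eq
  rewrite does-⇔ (eq zero) (P? zero) (Q? zero)
        | least-cong (P? ∘ suc) (Q? ∘ suc) (eq ∘ suc) = refl

least-sound : ∀ {m} {P : Fin m → Set} (P? : Decidable P) {x} → least P? ≡ just x → P x
least-sound {suc m} P? eq with P? zero | least (P? ∘ suc) in eq′
least-sound {suc m} P? refl | yes p | _      = p
least-sound {suc m} P? refl | no _  | just y = least-sound (P? ∘ suc) eq′

least-complete : ∀ {m} {P : Fin m → Set} (P? : Decidable P) {x} → P x → ∃ λ y → least P? ≡ just y
least-complete {suc m} P? {x} p with P? zero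
least-complete {suc m} P? {x}     p | yes _ = zero , refl
least-complete {suc m} P? {zero}  p | no ¬p = contradiction p ¬p
least-complete {suc m} P? {suc x} p | no _ with least-complete (P? ∘ suc) p
... | y , eq = suc y , cong (Maybe.map suc) eq

injective? : ∀ {m n} (f : Fin m → Fin n) → Dec (Injective f)
injective? f = map′ (λ h {x} {y} → h x y) (λ h x y → h)
  (Fin.all? λ x → Fin.all? λ y → (f x Fin.≟ f y) →-dec (x Fin.≟ y))

to-injective : ∀ {A B : Set} (π : A ↔ B) → Injective (Inverse.to π)
to-injective π {x} {y} eq =
  trans (sym (Inverse.strictlyInverseʳ π x)) (trans (cong (Inverse.from π) eq) (Inverse.strictlyInverseʳ π y))

from-injective : ∀ {A B : Set} (π : A ↔ B) → Injective (Inverse.from π)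
from-injective π = to-injective (↔-sym π)

reach-≤ : ∀ {δ n} {t : RTree δ n} {a b u v} → a ≤ b → Reach t a u v → Reach t b u v
reach-≤ le       here       = here
reach-≤ (s≤s le) (step e r) = step e (reach-≤ le r)

reach-snoc : ∀ {δ n} {t : RTree δ n} {a u v w} → Reach t a u v → Adj t v w → Reach t (suc a) u w
reach-snoc here       e = step e here
reach-snoc (step f r) e = step f (reach-snoc r e)

module _ {δ n : ℕ} {t t' : RTree δ n} where

  viewIso-sym : ∀ {R R' : Fin n → Set} π → ViewIso t t' R R' π → ViewIso t' t R' R (↔-sym π)
  viewIso-sym {R} {R'} π (mem , edge) = mem′ , edge′
    where
    open Inverse π
    tf : ∀ u → to (from u) ≡ u
    tf = strictlyInverseˡ
    mem′ : ∀ u → R' u ⇔ R (from u)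
    mem′ u = mk⇔ (λ r → Equivalence.from (mem (from u)) (subst R' (sym (tf u)) r))
                 (λ r → subst R' (tf u) (Equivalence.to (mem (from u)) r))
    edge′ : ∀ u w → R' u → R' w → (parent t' u ≡ just w) ⇔ (parent t (from u) ≡ just (from w))
    edge′ u w ru rw with edge (from u) (from w) (Equivalence.to (mem′ u) ru) (Equivalence.to (mem′ w) rw)
    ... | eqv rewrite tf u | tf w = mk⇔ (Equivalence.from eqv) (Equivalence.to eqv)

  -- A walk of length `a` from `y`, with `y` within `b` of `x` and `b + a ≤ T`, never leaves the
  -- `T`-ball of `x`. All its nodes lie in `R`, so the isomorphism carries over every edge.
  viewIso-reach : ∀ (R R' : Fin n → Set) π → ViewIso t t' R R' π → ∀ {T x} → (∀ {w} → Reach t T x w → R w) →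
                  ∀ {a b y u} → Reach t b x y → b + a ≤ T → Reach t a y u →
                  Reach t' a (Inverse.to π y) (Inverse.to π u)
  viewIso-reach R R' π iso inR rb le here = here
  viewIso-reach R R' π iso@(_ , edge) {T} {x} inR {suc a} {b} {y} rb le (step {w = w} e ra) =
    step (adj e) (viewIso-reach R R' π iso inR rb′ le′ ra)
    where
    le′ : suc b + a ≤ T
    le′ = subst (_≤ T) (ℕ.+-suc b a) le
    rb′ : Reach t (suc b) x w
    rb′ = reach-snoc rb e
    ry : R y
    ry = inR (reach-≤ (ℕ.≤-trans (ℕ.m≤m+n b (suc a)) le) rb)
    rw : R w
    rw = inR (reach-≤ (ℕ.≤-trans (ℕ.m≤m+n (suc b) a) le′) rb′)
    adj : Adj t y w → Adj t' (Inverse.to π y) (Inverse.to π w)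
    adj (inj₁ p) = inj₁ (Equivalence.to (edge y w ry rw) p)
    adj (inj₂ p) = inj₂ (Equivalence.to (edge w y rw ry) p)

module _ {δ n T : ℕ} {t t' : RTree δ n} {σ σ' : Fin n ↔ Fin n} {i : Fin n} where

  -- The ball of a presented node is part of the revealed region, so walks from its centre transfer
  -- forward along the isomorphism and back along its inverse. An online view thus contains a LOCAL
  -- view of each node presented so far.
  onlineView⇒ballIso : (view : OnlineView T t σ t' σ' i) → ∀ k → toℕ k ≤ toℕ i →
    ViewIso t t' (InBall t T (Inverse.to σ k)) (InBall t' T (Inverse.to σ' k)) (proj₁ view)
  onlineView⇒ballIso (π , match , iso@(mem , edge)) k k≤i = ball , λ u w ru rw → edge u w (k , k≤i , ru)
      (k , k≤i , rw)
    where
    open Inverse π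
    R = Revealed t T σ i
    R' = Revealed t' T σ' i
    v = Inverse.to σ k
    v' = Inverse.to σ' k
    back : from v' ≡ v
    back = trans (cong from (sym (match k k≤i))) (strictlyInverseʳ v)
    fwd : ∀ u → InBall t T v u → InBall t' T v' (to u)
    fwd u r = subst (λ z → Reach t' T z (to u)) (match k k≤i)
      (viewIso-reach R R' π iso (λ r → k , k≤i , r) {b = 0} here ℕ.≤-refl r)
    bwd : ∀ u → InBall t' T v' (to u) → InBall t T v u
    bwd u r = subst₂ (Reach t T) back (strictlyInverseʳ u)
      (viewIso-reach R' R (↔-sym π) (viewIso-sym {t = t} {t' = t'} {R = R} {R' = R'} π iso)
          (λ r → k , k≤i , r) {b = 0} here ℕ.≤-refl r)
    ball : ∀ u → InBall t T v u ⇔ InBall t' T v' (to u)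
    ball u = mk⇔ (fwd u) (bwd u)

-- Simulation of a LOCAL algorithm by an online one

-- The online algorithm keeps the labels produced so far consistent with some identifier
-- assignment for the LOCAL algorithm.  Whether such an assignment exists depends only on
-- what has been revealed, so choosing the least consistent label is legal in the model.
module Simulate (c : ℕ) (1≤c : 1 ≤ c) (Π : LCL) (n T : ℕ) (A : LocalAlg c Π n)
  (loc : HasLocalityLOCAL c Π n T A) (feas : ∀ t ids → Feasible Π t (A t ids)) where

  open LCL Π

  -- Answers are stored newest first, so the head answers the node whose step is the length of the
  -- tail.
  Consistent : RTree δ n → (Fin n ↔ Fin n) → IdAssign c n → List (Fin g) → Set
  Consistent t σ ids []       = ⊤
  Consistent t σ ids (a ∷ as) =
    (∀ k → toℕ k ≡ length as → A t ids (Inverse.to σ k) ≡ a) × Consistent t σ ids as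

  consistent? : ∀ t σ ids as → Dec (Consistent t σ ids as)
  consistent? t σ ids []       = yes tt
  consistent? t σ ids (a ∷ as) =
    (Fin.all? λ k → (toℕ k ℕ.≟ length as) →-dec (A t ids (Inverse.to σ k) Fin.≟ a))
    ×-dec consistent? t σ ids as

  Possible : RTree δ n → (Fin n ↔ Fin n) → List (Fin g) → Set
  Possible t σ as = Σ (IdAssign c n) λ ids → Consistent t σ ids as

  -- Pointwise equal assignments may carry different proofs of injectivity; locality, with the
  -- identity permutation as the view, shows that `A` cannot tell them apart.
  A-ext : ∀ t (ids ids' : IdAssign c n) → (∀ u → proj₁ ids' u ≡ proj₁ ids u) → ∀ v → A t ids v ≡ A t ids' v
  A-ext t ids ids' eq v = loc t ids v t ids' v
    (↔-id _ , refl , ((λ u → mk⇔ (λ r → r) (λ r → r)) , λ u w _ _ → mk⇔ (λ r → r) (λ r → r)) , λ u _ → eq u)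

  consistent-ext : ∀ t σ (ids ids' : IdAssign c n) → (∀ u → proj₁ ids' u ≡ proj₁ ids u) → ∀ as →
                   Consistent t σ ids as → Consistent t σ ids' as
  consistent-ext t σ ids ids' eq []       _       = tt
  consistent-ext t σ ids ids' eq (a ∷ as) (h , r) =
    (λ k e → trans (sym (A-ext t ids ids' eq _)) (h k e)) , consistent-ext t σ ids ids' eq as r

  PossibleVia : RTree δ n → (Fin n ↔ Fin n) → List (Fin g) → (Fin n → Fin (n ^ c)) → Set
  PossibleVia t σ as f = Σ (Injective f) λ inj → Consistent t σ (f , λ {x} {y} → inj {x} {y}) as

  possibleVia? : ∀ t σ as f → Dec (PossibleVia t σ as f)
  possibleVia? t σ as f with injective? f
  ... | no ¬inj = no λ p → ¬inj (proj₁ p)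
  ... | yes inj with consistent? t σ (f , λ {x} {y} → inj {x} {y}) as
  ...   | yes p = yes (inj , p)
  ...   | no ¬p = no λ p → ¬p (consistent-ext t σ _ _ (λ _ → refl) as (proj₂ p))

  -- Functions into the identifiers are coded by a finite type, so the search over all assignments
  -- is finite.
  possible? : ∀ t σ as → Dec (Possible t σ as)
  possible? t σ as = map′ out into (Fin.any? λ x → possibleVia? t σ as (finToFun x))
    where
    out : (∃ λ x → PossibleVia t σ as (finToFun x)) → Possible t σ as
    out (x , inj , p) = (finToFun x , inj) , p
    into : Possible t σ as → ∃ λ x → PossibleVia t σ as (finToFun x)
    into ((f , inj) , p) = funToFin f , inj′ , consistent-ext t σ (f , inj) _ (Fin.finToFun-funToFin f) as p
      where
      inj′ : Injective (finToFun (funToFin f))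
      inj′ {x} {y} e = inj (trans (sym (Fin.finToFun-funToFin f x)) (trans e (Fin.finToFun-funToFin f y)))

  nextLabel : RTree δ n → (Fin n ↔ Fin n) → List (Fin g) → Maybe (Fin g)
  nextLabel t σ as = least (λ a → possible? t σ (a ∷ as))

  history : RTree δ n → (Fin n ↔ Fin n) → ℕ → List (Fin g)
  history t σ zero    = []
  -- The default `[]` is never taken for `j < n`, by `nextLabel-exists`.
  history t σ (suc j) = maybe′ (_∷ history t σ j) [] (nextLabel t σ (history t σ j))

  ids₀ : RTree δ n → IdAssign c n
  ids₀ t = (λ u → inject≤ u (n≤n^c n c 1≤c)) , λ {x} {y} e → Fin.inject≤-injective _ _ x y e
    where
    n≤n^c : ∀ m d → 1 ≤ d → m ≤ m ^ d
    n≤n^c zero    _       _ = z≤n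
    n≤n^c (suc m) (suc d) _ = ℕ.m≤m*n (suc m) (suc m ^ d) {{ℕ.m^n≢0 (suc m) d}}

  -- The algorithm cannot get stuck: if `ids` explains the answers so far, then the label that `A`
  -- gives the next node under `ids` is a possible continuation. The invariant and this extension
  -- are proved together.
  history-possible : ∀ t σ j → j ≤ n → length (history t σ j) ≡ j × Possible t σ (history t σ j)
  nextLabel-exists : ∀ t σ j → j < n → ∃ λ a → nextLabel t σ (history t σ j) ≡ just a

  history-possible t σ zero    _   = refl , ids₀ t , tt
  history-possible t σ (suc j) j<n with nextLabel-exists t σ j j<n
  ... | a , eq rewrite eq =
    cong suc (proj₁ (history-possible t σ j (ℕ.<⇒≤ j<n))) , least-sound
        (λ a → possible? t σ (a ∷ history t σ j)) eq

  nextLabel-exists t σ j j<n with history-possible t σ j (ℕ.<⇒≤ j<n)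
  ... | len , ids , p =
    least-complete (λ a → possible? t σ (a ∷ history t σ j)) {A t ids (Inverse.to σ (fromℕ< j<n))}
      (ids , (λ k e → cong (λ z → A t ids (Inverse.to σ z))
        (Fin.toℕ-injective (trans e (trans len (sym (Fin.toℕ-fromℕ< j<n)))))) , p)

  onlineAlg : OnlineAlg Π n
  onlineAlg t σ i = maybe′ (λ a → a) (A t (ids₀ t) (Inverse.to σ i)) (nextLabel t σ (history t σ (toℕ i)))

  -- Identifiers are transported along `π`. Each recorded answer is determined by a ball common to
  -- both views, so it survives; the length bound keeps the comparison to nodes presented up to step
  -- `i`.
  possible-view : ∀ t σ t' σ' i → OnlineView T t σ t' σ' i → ∀ as → length as ≤ suc (toℕ i) →
                  Possible t σ as ⇔ Possible t' σ' as
  possible-view t σ t' σ' i view@(π , match , _) as₀ le₀ = mk⇔ fwd bwd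
    where
    open Inverse π
    same : (ids ids' : IdAssign c n) → (∀ u → proj₁ ids' (to u) ≡ proj₁ ids u) → ∀ k → toℕ k ≤ toℕ i →
           A t ids (Inverse.to σ k) ≡ A t' ids' (Inverse.to σ' k)
    same ids ids' eq k k≤i = loc t ids _ t' ids' _
      (π , match k k≤i , onlineView⇒ballIso {σ = σ} {σ' = σ'} {i = i} view k k≤i , λ u _ → eq u)
    fwd-as : (ids ids' : IdAssign c n) → (∀ u → proj₁ ids' (to u) ≡ proj₁ ids u) → ∀ as → length as ≤ suc
        (toℕ i) →
             Consistent t σ ids as → Consistent t' σ' ids' as
    fwd-as ids ids' eq []       _        _       = tt
    fwd-as ids ids' eq (a ∷ as) (s≤s le) (h , p) =
      (λ k e → trans (sym (same ids ids' eq k (subst (_≤ toℕ i) (sym e) le))) (h k e))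
      , fwd-as ids ids' eq as (ℕ.m≤n⇒m≤1+n le) p
    bwd-as : (ids ids' : IdAssign c n) → (∀ u → proj₁ ids' (to u) ≡ proj₁ ids u) → ∀ as → length as ≤ suc
        (toℕ i) →
             Consistent t' σ' ids' as → Consistent t σ ids as
    bwd-as ids ids' eq []       _        _       = tt
    bwd-as ids ids' eq (a ∷ as) (s≤s le) (h , p) =
      (λ k e → trans (same ids ids' eq k (subst (_≤ toℕ i) (sym e) le)) (h k e))
      , bwd-as ids ids' eq as (ℕ.m≤n⇒m≤1+n le) p
    fwd : Possible t σ as₀ → Possible t' σ' as₀
    fwd (ids@(f , inj) , p) =
      ids′ , fwd-as ids ids′ (λ u → cong f (strictlyInverseʳ u)) as₀ le₀ p
      where
      ids′ : IdAssign c n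
      ids′ = (λ u → f (from u)) , λ e → from-injective π (inj e)
    bwd : Possible t' σ' as₀ → Possible t σ as₀
    bwd (ids@(f , inj) , p) =
      ids′ , bwd-as ids′ ids (λ u → refl) as₀ le₀ p
      where
      ids′ : IdAssign c n
      ids′ = (λ u → f (to u)) , λ e → to-injective π (inj e)

  history-view : ∀ t σ t' σ' i → OnlineView T t σ t' σ' i → ∀ j → j ≤ suc (toℕ i) →
                 history t σ j ≡ history t' σ' j
  nextLabel-view : ∀ t σ t' σ' i → OnlineView T t σ t' σ' i → ∀ j → j ≤ toℕ i →
                   nextLabel t σ (history t σ j) ≡ nextLabel t' σ' (history t' σ' j)

  history-view t σ t' σ' i view zero    _        = refl
  history-view t σ t' σ' i view (suc j) (s≤s le)
    rewrite nextLabel-view t σ t' σ' i view j le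
          | history-view t σ t' σ' i view j (ℕ.m≤n⇒m≤1+n le) = refl

  nextLabel-view t σ t' σ' i view j le = trans
    (least-cong _ (λ a → possible? t' σ' (a ∷ history t σ j))
      (λ a → possible-view t σ t' σ' i view (a ∷ history t σ j) (s≤s len)))
    (cong (nextLabel t' σ') (history-view t σ t' σ' i view j (ℕ.m≤n⇒m≤1+n le)))
    where
    len : length (history t σ j) ≤ toℕ i
    len = subst (_≤ toℕ i) (sym (proj₁ (history-possible t σ j (ℕ.≤-trans le (ℕ.<⇒≤ (Fin.toℕ<n i)))))) le

  onlineAlg-just : ∀ t σ i {a} → nextLabel t σ (history t σ (toℕ i)) ≡ just a → onlineAlg t σ i ≡ a
  onlineAlg-just t σ i eq rewrite eq = refl

  onlineAlg-locality : HasLocalityOnline Π n T onlineAlg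
  onlineAlg-locality t σ t' σ' i view with nextLabel-exists t σ (toℕ i) (Fin.toℕ<n i)
  ... | a , eq = trans (onlineAlg-just t σ i eq)
    (sym (onlineAlg-just t' σ' i (trans (sym (nextLabel-view t σ t' σ' i view (toℕ i) ℕ.≤-refl)) eq)))

  consistent-history : ∀ t σ ids j → j ≤ n → Consistent t σ ids (history t σ j) → ∀ i → toℕ i < j →
                       A t ids (Inverse.to σ i) ≡ onlineAlg t σ i
  consistent-history t σ ids (suc j) j<n p i (s≤s i≤j) with nextLabel-exists t σ j j<n
  ... | a , eq rewrite eq with toℕ i ℕ.≟ j
  ...   | yes e = trans (proj₁ p i (trans e (sym (proj₁ (history-possible t σ j (ℕ.<⇒≤ j<n))))))
                    (sym (onlineAlg-just t σ i (trans (cong (λ z → nextLabel t σ (history t σ z)) e) eq)))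
  ...   | no ¬e = consistent-history t σ ids j (ℕ.<⇒≤ j<n) (proj₂ p) i (ℕ.≤∧≢⇒< i≤j ¬e)

  -- After `n` steps a single assignment explains the whole history, so the online output coincides
  -- with an output of `A`.
  onlineAlg-feasible : ∀ t σ → Feasible Π t (λ v → onlineAlg t σ (Inverse.from σ v))
  onlineAlg-feasible t σ with history-possible t σ n ℕ.≤-refl
  ... | _ , ids , p = feasible-ext (feas t ids)
    where
    eq : ∀ v → A t ids v ≡ onlineAlg t σ (Inverse.from σ v)
    eq v = trans (cong (A t ids) (sym (Inverse.strictlyInverseˡ σ v)))
                 (consistent-history t σ ids n ℕ.≤-refl p (Inverse.from σ v) (Fin.toℕ<n _))
    feasible-ext : Feasible Π t (A t ids) → Feasible Π t (λ v → onlineAlg t σ (Inverse.from σ v))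
    feasible-ext f v ce with f v ce
    ... | e , m = e , subst (_∈ C) (cong₂ _,_ (eq v) (tabulate-cong (λ i → eq (proj₁ e i)))) m

local⇒online : ∀ c → 1 ≤ c → ∀ Π n T → SolvesLOCAL c Π n T → SolvesOnline Π n T
local⇒online c 1≤c Π n T (A , loc , feas) = onlineAlg , onlineAlg-locality , onlineAlg-feasible
  where open Simulate c 1≤c Π n T A loc feas

funToFin-cong : ∀ {m n} {f f' : Fin m → Fin n} → (∀ i → f i ≡ f' i) → funToFin f ≡ funToFin f'
funToFin-cong {zero}  eq = refl
funToFin-cong {suc m} eq = cong₂ combine (eq zero) (funToFin-cong (eq ∘ suc))

funToFin-injective : ∀ {m n} (f f' : Fin m → Fin n) → funToFin f ≡ funToFin f' → ∀ i → f i ≡ f' i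
funToFin-injective f f' eq i =
  trans (sym (Fin.finToFun-funToFin f i)) (trans (cong (λ z → finToFun z i) eq) (Fin.finToFun-funToFin f' i))

-- Colour reduction and ruling sets on the sequence of ancestors of a node

Proper : ∀ {m} → ℕ → (ℕ → Fin m) → Set
Proper D s = ∀ i j → 1 ≤ j → j ≤ D → s i ≢ s (i + j)

module CoinTossing (B : ℕ) where

  differAt? : (x y : Fin (2 ^ B)) (b : Fin B) → Dec (finToFun {2} {B} x b ≢ finToFun {2} {B} y b)
  differAt? x y b = ¬? (finToFun {2} {B} x b Fin.≟ finToFun {2} {B} y b)

  -- The Cole-Vishkin step: the first position at which `x` and `y` differ, together with the bit of
  -- `x` there. The value `zero` is reserved for `x ≡ y`.
  toss : Fin (2 ^ B) → Fin (2 ^ B) → Fin (suc (B * 2))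
  toss x y = maybe′ (λ b → suc (combine b (finToFun {2} {B} x b))) zero (least (differAt? x y))

  -- Equal results would name the same position with the same bit in `x` and `y`, although `x` and
  -- `y` differ there.
  toss-≢ : ∀ x y z → x ≢ y → toss x y ≢ toss y z
  toss-≢ x y z x≢y eq with Fin.any? (differAt? x y)
  ... | no same = x≢y (begin
      x                              ≡⟨ sym (Fin.funToFin-finToFin {B} {2} x) ⟩
      funToFin (finToFun {2} {B} x)  ≡⟨ funToFin-cong agree ⟩
      funToFin (finToFun {2} {B} y)  ≡⟨ Fin.funToFin-finToFin {B} {2} y ⟩
      y                              ∎)
    where
    open ≡-Reasoning
    agree : ∀ b → finToFun {2} {B} x b ≡ finToFun {2} {B} y b
    agree b with finToFun {2} {B} x b Fin.≟ finToFun {2} {B} y b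
    ... | yes e = e
    ... | no ne = contradiction (b , ne) same
  ... | yes (b₀ , ne) with least-complete (differAt? x y) {b₀} ne
  ...   | b , eqb with least (differAt? x y) | least-sound (differAt? x y) {b} eqb | eqb | least (differAt? y z)
  ...     | just .b | ne′ | refl | just b′ with Fin.combine-injective b _ b′ _ (Fin.suc-injective eq)
  ...       | refl , bit = ne′ bit

  module _ (D : ℕ) where

    -- A toss against the next entry alone would preserve properness at distance 1 only. One toss
    -- per distance preserves all distances up to `D`, at the price of a `D`-th power in the number
    -- of colours.
    reduce : (ℕ → Fin (2 ^ B)) → ℕ → Fin (suc (B * 2) ^ D)
    reduce s i = funToFin {D} (λ d → toss (s i) (s (i + suc (toℕ d))))

    reduce-proper : ∀ s → Proper D s → Proper D (reduce s)
    reduce-proper s proper i (suc j) _ j<D eq =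
      toss-≢ _ _ _ (proper i (suc j) (s≤s z≤n) j<D)
        (subst (λ x → toss (s i) (s (i + suc x)) ≡ toss (s (i + suc j)) (s (i + suc j + suc x)))
          (Fin.toℕ-fromℕ< j<D) (funToFin-injective {D} _ _ eq (fromℕ< j<D)))

    reduce-cong : ∀ s s' i i' → (∀ x → x ≤ D → s (i + x) ≡ s' (i' + x)) → reduce s i ≡ reduce s' i'
    reduce-cong s s' i i' eq = funToFin-cong {D} λ d →
      cong₂ toss
        (trans (cong s (sym (ℕ.+-identityʳ i))) (trans (eq 0 z≤n) (cong s' (ℕ.+-identityʳ i'))))
        (eq (suc (toℕ d)) (Fin.toℕ<n d))

anyBelow : ℕ → (ℕ → Bool) → Bool
anyBelow zero    f = false
anyBelow (suc k) f = f k ∨ anyBelow k f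

anyBelow-intro : ∀ k f e → e < k → f e ≡ true → anyBelow k f ≡ true
anyBelow-intro (suc k) f e (s≤s e≤k) p with e ℕ.≟ k
... | yes refl rewrite p = refl
... | no e≢k rewrite anyBelow-intro k f e (ℕ.≤∧≢⇒< e≤k e≢k) p = ∨-zeroʳ (f k)

anyBelow-elim : ∀ k f → anyBelow k f ≡ true → ∃ λ e → e < k × f e ≡ true
anyBelow-elim (suc k) f p with f k in eq
... | true  = k , ℕ.≤-refl , eq
... | false with anyBelow-elim k f p
...   | e , e<k , q = e , ℕ.m≤n⇒m≤1+n e<k , q

anyBelow-cong : ∀ k f f' → (∀ e → e < k → f e ≡ f' e) → anyBelow k f ≡ anyBelow k f'
anyBelow-cong zero    f f' eq = refl
anyBelow-cong (suc k) f f' eq =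
  cong₂ _∨_ (eq k ℕ.≤-refl) (anyBelow-cong k f f' (λ e e<k → eq e (ℕ.m≤n⇒m≤1+n e<k)))

module Marks (d : ℕ) where

  D width : ℕ
  D     = suc d
  width = d + suc d

  -- Greedy maximal D-spaced set, colour class by colour class; round a is read D·a positions
  -- further up the sequence, so that only ancestors are ever inspected.
  marked : (ℕ → ℕ) → ℕ → ℕ → Bool
  marked χ zero    i = false
  marked χ (suc a) i = marked χ a (i + D)
    ∨ ((χ (i + suc a * D) ≡ᵇ a) ∧ not (anyBelow width (λ e → marked χ a (i + suc e))))

  data New (χ : ℕ → ℕ) (a i : ℕ) : Set where
    old : marked χ a (i + D) ≡ true → New χ a i
    new : χ (i + suc a * D) ≡ a → anyBelow width (λ e → marked χ a (i + suc e)) ≡ false → New χ a i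

  marked-suc : ∀ χ a i → marked χ (suc a) i ≡ true → New χ a i
  marked-suc χ a i p with marked χ a (i + D) in eq₁
  ... | true  = old eq₁
  ... | false with χ (i + suc a * D) ≡ᵇ a in eq₂ | anyBelow width (λ e → marked χ a (i + suc e)) in eq₃
  ...   | true | false = new (ℕ.≡ᵇ⇒≡ _ _ (Equivalence.from T-≡ eq₂)) eq₃

  Spaced : (ℕ → Bool) → Set
  Spaced μ = ∀ i j → 1 ≤ j → j < D → μ i ≡ true → μ (i + j) ≡ true → ⊥

  Dense : (ℕ → Bool) → Set
  Dense μ = ∀ i → ∃ λ e → e < width × μ (i + e) ≡ true

  -- Two old marks are handled by induction, two new ones share a colour at distance below `D`. For
  -- one of each: the scanned positions `i + 1` to `i + 2D − 1` are centred at `i + D`, which is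
  -- where `i` stood in the previous round, and reach `D − 1` to either side.
  marked-spaced : ∀ χ → (∀ i j → 1 ≤ j → j ≤ D → χ i ≢ χ (i + j)) → ∀ a → Spaced (marked χ a)
  marked-spaced χ proper (suc a) i j 1≤j j<D p q with marked-suc χ a i p | marked-suc χ a (i + j) q
  ... | old p′ | old q′ = marked-spaced χ proper a (i + D) j 1≤j j<D p′
        (trans (cong (marked χ a) (trans (ℕ.+-assoc i D j)
            (trans (cong (i +_) (ℕ.+-comm D j)) (sym (ℕ.+-assoc i j D))))) q′)
  ... | new c _ | new c′ _ = proper (i + suc a * D) j 1≤j (ℕ.<⇒≤ j<D)
        (trans c (trans (sym c′) (cong χ (trans (ℕ.+-assoc i j _)
            (trans (cong (i +_) (ℕ.+-comm j _)) (sym (ℕ.+-assoc i _ j)))))))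
  ... | old p′ | new _ none with ℕ.m≤n⇒∃[o]m+o≡n (ℕ.≤-pred j<D)
  ...   | e , refl = contradiction (trans (sym none) (anyBelow-intro width _ e
            (ℕ.≤-trans (s≤s (ℕ.m≤n+m e j)) (ℕ.m≤n+m D d)) (trans (cong (marked χ a) eq) p′))) λ ()
    where
    eq : i + j + suc e ≡ i + suc (j + e)
    eq = trans (ℕ.+-assoc i j (suc e)) (cong (i +_) (ℕ.+-suc j e))
  marked-spaced χ proper (suc a) i (suc j) 1≤j j<D p q | new _ none | old q′ =
    contradiction (trans (sym none) (anyBelow-intro width _ (j + D) (ℕ.+-monoˡ-≤ D (ℕ.≤-pred j<D))
      (trans (cong (marked χ a) (sym (ℕ.+-assoc i (suc j) D))) q′))) λ ()

  marked-old : ∀ χ a i → marked χ a (i + D) ≡ true → marked χ (suc a) i ≡ true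
  marked-old χ a i p rewrite p = refl

  marked-new : ∀ χ a i → χ (i + suc a * D) ≡ a → anyBelow width (λ e → marked χ a (i + suc e)) ≡ false →
               marked χ (suc a) i ≡ true
  marked-new χ a i c none rewrite none | Equivalence.to T-≡ (ℕ.≡⇒≡ᵇ (χ (i + suc a * D)) a c) = ∨-zeroʳ _

  -- The window from `i` is centred at `i + d`, and `χ (i + d + a * D)` is the colour of that
  -- centre. Once this colour has been processed, either the centre was marked or something in the
  -- window blocked it, and marks are never removed.
  marked-dense : ∀ χ a i → χ (i + d + a * D) < a → ∃ λ e → e < width × marked χ a (i + e) ≡ true
  marked-dense χ (suc a) i (s≤s c≤a) with χ (i + d + suc a * D) ℕ.≟ a
  ... | no c≢a with marked-dense χ a (i + D) (subst (λ z → χ z < a) shift (ℕ.≤∧≢⇒< c≤a c≢a))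
    where
    shift : i + d + (D + a * D) ≡ i + D + d + a * D
    shift = trans (sym (ℕ.+-assoc (i + d) D (a * D))) (cong (_+ a * D)
      (trans (ℕ.+-assoc i d D) (trans (cong (i +_) (ℕ.+-comm d D)) (sym (ℕ.+-assoc i D d)))))
  ...   | e , e<w , p = e , e<w , marked-old χ a (i + e) (trans (cong (marked χ a) eq) p)
    where
    eq : i + e + D ≡ i + D + e
    eq = trans (ℕ.+-assoc i e D) (trans (cong (i +_) (ℕ.+-comm e D)) (sym (ℕ.+-assoc i D e)))
  marked-dense χ (suc a) i (s≤s c≤a) | yes c≡a
    with anyBelow width (λ e → marked χ a (i + d + suc e)) in eq
  ... | false = d , ℕ.≤-trans ℕ.≤-refl (ℕ.m≤n+m D d) , marked-new χ a (i + d) c≡a eq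
  ... | true with anyBelow-elim width _ eq
  ...   | e , e<w , p = e , e<w , marked-old χ a (i + e) (trans (cong (marked χ a) eq′) p)
    where
    eq′ : i + e + D ≡ i + d + suc e
    eq′ = trans (ℕ.+-assoc i e D) (trans (cong (i +_) (trans (ℕ.+-comm e D) (sym (ℕ.+-suc d e))))
        (sym (ℕ.+-assoc i d (suc e))))

  -- One round shifts by `D` and scans fewer than `D` positions beyond that, so each round looks
  -- less than `D + D` further.
  marked-cong : ∀ χ χ' a i i' → (∀ x → x ≤ a * (D + D) → χ (i + x) ≡ χ' (i' + x)) → marked χ a i
      ≡ marked χ' a i'
  marked-cong χ χ' zero    i i' eq = refl
  marked-cong χ χ' (suc a) i i' eq = cong₂ _∨_
    (marked-cong χ χ' a (i + D) (i' + D) (λ x x≤ → shifted D (ℕ.m≤m+n D D) x x≤))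
    (cong₂ (λ u v → (u ≡ᵇ a) ∧ not v)
      (eq (suc a * D) (ℕ.*-monoʳ-≤ (suc a) (ℕ.m≤m+n D D)))
      (anyBelow-cong width _ _ λ e e<w →
        marked-cong χ χ' a (i + suc e) (i' + suc e)
          (λ x x≤ → shifted (suc e) (ℕ.≤-trans e<w (ℕ.+-monoˡ-≤ D (ℕ.n≤1+n d))) x x≤)))
    where
    shifted : ∀ k → k ≤ D + D → ∀ x → x ≤ a * (D + D) → χ (i + k + x) ≡ χ' (i' + k + x)
    shifted k k≤ x x≤ = trans (cong χ (ℕ.+-assoc i k x))
        (trans (eq (k + x) (ℕ.+-mono-≤ k≤ x≤)) (cong χ' (sym (ℕ.+-assoc i' k x))))

-- Certificates and the labelling of a marked path

first : (ℕ → Bool) → ℕ → ℕ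
first f zero       = zero
first f (suc fuel) = if f 0 then 0 else suc (first (f ∘ suc) fuel)

IsFirst : (ℕ → Bool) → ℕ → Set
IsFirst f x = f x ≡ true × (∀ y → y < x → f y ≡ false)

first-unique : ∀ f fuel x → IsFirst f x → x ≤ fuel → first f fuel ≡ x
first-unique f zero       zero    _         _        = refl
first-unique f (suc fuel) zero    (p , _)   _        rewrite p = refl
first-unique f (suc fuel) (suc x) (p , min) (s≤s le) rewrite min 0 (s≤s z≤n) =
  cong suc (first-unique (f ∘ suc) fuel x (p , λ y y<x → min (suc y) (s≤s y<x)) le)

first-exists : ∀ f x → f x ≡ true → ∃ λ y → y ≤ x × IsFirst f y
first-exists f x p with f 0 in eq
... | true = 0 , z≤n , eq , λ _ ()
first-exists f zero    p | false = contradiction (trans (sym p) eq) λ ()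
first-exists f (suc x) p | false with first-exists (f ∘ suc) x p
... | y , y≤x , q , min = suc y , s≤s y≤x , q , λ { zero _ → eq ; (suc z) (s≤s z<y) → min z z<y }

first-≤ : ∀ f fuel → first f fuel ≤ fuel
first-≤ f zero = z≤n
first-≤ f (suc fuel) with f 0
... | true  = z≤n
... | false = s≤s (first-≤ (f ∘ suc) fuel)

first-cong : ∀ f f' fuel → (∀ x → x < fuel → f x ≡ f' x) → first f fuel ≡ first f' fuel
first-cong f f' zero       eq = refl
first-cong f f' (suc fuel) eq
  rewrite eq 0 (s≤s z≤n) | first-cong (f ∘ suc) (f' ∘ suc) fuel (λ x x<k → eq (suc x) (s≤s x<k)) = refl

module _ (Π : LCL) where

  open LCL Π

  -- Words list the child indices on a downward path, deepest step first.
  Word : Set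
  Word = List (Fin δ)

  -- Certificates address children by fixed indices, while `Feasible` lets the enumeration of the
  -- children be chosen; `ρ` records that choice.
  AllowedUpToOrder : Fin g → (Fin δ → Fin g) → Set
  AllowedUpToOrder a b = Σ (Fin δ → Fin δ) λ ρ →
    Injective ρ × (∀ i → ∃ λ j → ρ j ≡ i) × (a , tabulate (b ∘ ρ)) ∈ C

  -- The index e stands for the depth D + e with D = suc d: a leaf labelling of the complete tree
  -- of that depth is completed below every label that occurs among the leaves.
  record Certificate : Set₁ where
    field
      d        : ℕ
      I        : Set
      name     : I → Fin g
      leaf     : Fin (suc d) → Word → I
      lab      : Fin (suc d) → I → Word → Fin g
      lab-root : ∀ e x → lab e x [] ≡ name x
      lab-leaf : ∀ e x u → length u ≡ suc d + toℕ e → lab e x u ≡ name (leaf e u)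
      lab-conf : ∀ e x u → length u < suc d + toℕ e → AllowedUpToOrder (lab e x u) (λ i → lab e x (i ∷ u))

module Stream {δ : ℕ} where

  word : (ℕ → Fin δ) → ℕ → ℕ → List (Fin δ)
  word ix a zero    = []
  word ix a (suc k) = ix a ∷ word ix (suc a) k

  word-length : ∀ ix a k → length (word ix a k) ≡ k
  word-length ix a zero    = refl
  word-length ix a (suc k) = cong suc (word-length ix (suc a) k)

  word-cong : ∀ ix ix' a a' k → (∀ x → x < k → ix (a + x) ≡ ix' (a' + x)) → word ix a k ≡ word ix' a' k
  word-cong ix ix' a a' zero    eq = refl
  word-cong ix ix' a a' (suc k) eq = cong₂ _∷_
    (trans (cong ix (sym (ℕ.+-identityʳ a))) (trans (eq 0 (s≤s z≤n)) (cong ix' (ℕ.+-identityʳ a'))))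
    (word-cong ix ix' (suc a) (suc a') k λ x x<k →
      trans (cong ix (sym (ℕ.+-suc a x))) (trans (eq (suc x) (s≤s x<k)) (cong ix' (ℕ.+-suc a' x))))

open Stream

-- A node is special when its K-th ancestor is marked.  Shifting the marks down by K ≥ 2D
-- makes the distance ℓ from a special node to the special nodes below it the same on all
-- branches and known to all nodes in between.
module Labelling (Π : LCL) (cert : Certificate Π) where

  open LCL Π
  open Certificate cert
  open Marks d

  K : ℕ
  K = D + D

  -- Inverse of `e ↦ D + e` on `D ≤ ℓ < 2D`; the reduction modulo `D` makes it total.
  depthIndex : ℕ → Fin D
  depthIndex ℓ = (ℓ ∸ D) mod D

  depthIndex-correct : ∀ ℓ → D ≤ ℓ → ℓ < D + D → D + toℕ (depthIndex ℓ) ≡ ℓ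
  depthIndex-correct ℓ D≤ℓ ℓ<2D = begin
    D + toℕ ((ℓ ∸ D) mod D)  ≡⟨ cong (D +_) (Fin.toℕ-fromℕ< (m%n<n (ℓ ∸ D) D)) ⟩
    D + (ℓ ∸ D) % D          ≡⟨ cong (D +_) (m<n⇒m%n≡m lt) ⟩
    D + (ℓ ∸ D)              ≡⟨ ℕ.m+[n∸m]≡n D≤ℓ ⟩
    ℓ                        ∎
    where
    open ≡-Reasoning
    lt : ℓ ∸ D < D
    lt = ℕ.+-cancelˡ-< D (ℓ ∸ D) D (subst (_< D + D) (sym (ℕ.m+[n∸m]≡n D≤ℓ)) ℓ<2D)

  -- For a node whose `i`-th ancestor has mark `μ i`: `up` is the distance to the special node at or
  -- above it, `suc down` the distance to the special level below, `suc next` the distance between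
  -- the two nearest special nodes upward. `down` can be read off ancestors because a node `s ≤ K`
  -- levels below has as its `K`-th ancestor the `(K − s)`-th ancestor of the present one.
  up down next : (ℕ → Bool) → ℕ
  up   μ = first (λ x → μ (K + x)) K
  down μ = first (λ x → μ (K ∸ suc x)) K
  next μ = first (λ x → μ (K + up μ + suc x)) K

  -- The node sits at depth `up μ` of a tree of depth `up μ + suc (down μ)`. The label on top of
  -- that tree is a leaf name of the tree above, found from the address alone; nothing further up is
  -- consulted.
  label : (ℕ → Bool) → (ℕ → Fin δ) → Fin g
  label μ ix = lab (depthIndex (up μ + suc (down μ)))
                   (leaf (depthIndex (suc (next μ))) (word ix (up μ) (suc (next μ))))
                   (word ix 0 (up μ))

  record Position (μ : ℕ → Bool) : Set where
    field
      j e f    : ℕ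
      j-first  : IsFirst (λ x → μ (K + x)) j
      j≤K      : j ≤ K
      j<width  : j < width
      e-first  : IsFirst (λ x → μ (K ∸ suc x)) e
      e<K      : suc e < K
      f-first  : IsFirst (λ x → μ (K + j + suc x)) f
      f<width  : f < width
      ℓ≥D      : D ≤ j + suc e
      ℓ<2D     : j + suc e < D + D

  width<K : width < K
  width<K = ℕ.≤-refl

  -- `dense K` yields the special node above, `dense 1` a special level among the next `K − 1`
  -- below. The marks at `r = K ∸ suc e` and `K + j` are consecutive, so spacing bounds their
  -- distance from below and density from above.
  position : ∀ μ → Spaced μ → Dense μ → Position μ
  position μ spaced dense with dense K
  ... | j₀ , j₀<w , pj₀ with first-exists (λ x → μ (K + x)) j₀ pj₀
  ...   | j , j≤j₀ , jf with dense (K + j + 1) | dense 1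
  ...     | f₀ , f₀<w , pf₀ | r₀ , r₀<w , pr₀
      with first-exists (λ x → μ (K + j + suc x)) f₀ (trans (cong μ (sym (ℕ.+-assoc (K + j) 1 f₀))) pf₀)
         | ℕ.m≤n⇒∃[o]m+o≡n r₀<w
  ...       | f , f≤f₀ , ff | e₀ , we
      with first-exists (λ x → μ (K ∸ suc x)) e₀ (trans (cong μ eq) pr₀)
    where
    eq : K ∸ suc e₀ ≡ suc r₀
    eq = trans (cong (λ z → suc z ∸ suc e₀) (sym we)) (ℕ.m+n∸n≡m (suc r₀) e₀)
  ...         | e , e≤e₀ , ef = record
      { j = j ; e = e ; f = f ; j-first = jf ; j≤K = ℕ.≤-trans (ℕ.<⇒≤ j<w) (ℕ.<⇒≤ width<K)
      ; j<width = j<w ; e-first = ef ; e<K = e<K ; f-first = ff ; f<width = ℕ.≤-<-trans f≤f₀ f₀<w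
      ; ℓ≥D = ℕ.≮⇒≥ λ lt → spaced r (j + suc e) (ℕ.≤-trans (s≤s z≤n) (ℕ.m≤n+m (suc e) j)) lt (proj₁ ef)
                (trans (cong μ r+ℓ) (proj₁ jf))
      ; ℓ<2D = ℓ<2D }
    where
    r = K ∸ suc e
    j<w : j < width
    j<w = ℕ.≤-<-trans j≤j₀ j₀<w
    e<K : suc e < K
    e<K = s≤s (ℕ.≤-trans (s≤s e≤e₀) (subst (suc e₀ ≤_) we (ℕ.m<n+m e₀ (s≤s z≤n))))
    r+suce : r + suc e ≡ K
    r+suce = ℕ.m∸n+n≡m (ℕ.<⇒≤ e<K)
    r+ℓ : r + (j + suc e) ≡ K + j
    r+ℓ = trans (cong (r +_) (ℕ.+-comm j (suc e))) (trans (sym (ℕ.+-assoc r (suc e) j)) (cong (_+ j) r+suce))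
    unmarked : ∀ y → r < y → y < K + j → μ y ≡ false
    unmarked y r<y y<p with y ℕ.<? K
    ... | yes y<K = trans (cong μ (sym (eq′))) (proj₂ ef (K ∸ suc y) (ℕ.+-cancelˡ-< r _ _ lt))
      where
      eq′ : K ∸ suc (K ∸ suc y) ≡ y
      eq′ = trans (cong (K ∸_) (sym (ℕ.+-∸-assoc 1 y<K))) (ℕ.m∸[m∸n]≡n (ℕ.<⇒≤ y<K))
      open ℕ.≤-Reasoning
      lt : r + (K ∸ suc y) < r + e
      lt = ℕ.≤-pred (begin-strict
        suc (r + (K ∸ suc y))    ≤⟨ ℕ.+-monoˡ-≤ (K ∸ suc y) r<y ⟩
        y + (K ∸ suc y)          <⟨ ℕ.≤-refl ⟩
        suc y + (K ∸ suc y)      ≡⟨ ℕ.m+[n∸m]≡n y<K ⟩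
        K                        ≡⟨ sym r+suce ⟩
        r + suc e                ≡⟨ ℕ.+-suc r e ⟩
        suc (r + e)              ∎)
    ... | no y≮K with ℕ.m≤n⇒∃[o]m+o≡n (ℕ.≮⇒≥ y≮K)
    ...   | x , refl = proj₂ jf x (ℕ.+-cancelˡ-< K x j y<p)
    ℓ<2D : j + suc e < D + D
    ℓ<2D with dense (suc r)
    ... | s , s<w , ps = ℕ.≤-<-trans (ℕ.+-cancelˡ-≤ r _ _ (ℕ.≮⇒≥ notbelow)) (s≤s s<w)
      where
      notbelow : ¬ (r + suc s < r + (j + suc e))
      notbelow lt = contradiction (trans (sym ps) (unmarked (suc r + s) (s≤s (ℕ.m≤m+n r s))
        (subst₂ _<_ (ℕ.+-suc r s) r+ℓ lt))) λ ()

  module _ {μ : ℕ → Bool} (pos : Position μ) where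
    open Position pos

    up≡ : up μ ≡ j
    up≡ = first-unique _ K j j-first j≤K
    down≡ : down μ ≡ e
    down≡ = first-unique _ K e e-first (ℕ.<⇒≤ (ℕ.<⇒≤ e<K))
    next≡ : next μ ≡ f
    next≡ = trans (cong (λ z → first (λ x → μ (K + z + suc x)) K) up≡)
                  (first-unique _ K f f-first (ℕ.<⇒≤ (ℕ.<-trans f<width width<K)))

  module _ (μ : ℕ → Bool) (ix : ℕ → Fin δ) (pos : Position μ) where

    open Position pos

    ℓ : ℕ
    ℓ = j + suc e

    origin : I
    origin = leaf (depthIndex (suc f)) (word ix j (suc f))

    label≡ : label μ ix ≡ lab (depthIndex ℓ) origin (word ix 0 j)
    label≡ = trans
      (cong₂ (λ a b → lab (depthIndex (a + suc b))
          (leaf (depthIndex (suc (next μ))) (word ix a (suc (next μ)))) (word ix 0 a))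
        (up≡ pos) (down≡ pos))
      (cong (λ a → lab (depthIndex ℓ) (leaf (depthIndex (suc a)) (word ix j (suc a))) (word ix 0 j))
          (next≡ pos))

    -- For `e = 0` the children are special: each tops a new tree, and `lab-root` and `lab-leaf`
    -- glue its top to a leaf of the present tree. Otherwise a child lies in the same tree, one
    -- level deeper.
    child-label : ∀ μ' ix' → (∀ i → μ' (suc i) ≡ μ i) → (∀ i → ix' (suc i) ≡ ix i) →
                  label μ' ix' ≡ lab (depthIndex ℓ) origin (ix' 0 ∷ word ix 0 j)
    child-label μ' ix' sμ six = go e refl
      where
      tail≡ : word ix' 1 j ≡ word ix 0 j
      tail≡ = word-cong ix' ix 1 0 j (λ x _ → six x)
      go : ∀ e₁ → e₁ ≡ e → label μ' ix' ≡ lab (depthIndex ℓ) origin (ix' 0 ∷ word ix 0 j)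
      go zero refl = begin
        label μ' ix'                                               ≡⟨ cong₂
            (λ a b → lab (depthIndex (a + suc (down μ')))
                                                                        (leaf (depthIndex (suc b))
                                                                            (word ix' a (suc b)))
                                                                            (word ix' 0 a)) up′ next′ ⟩
        lab _ (leaf (depthIndex (suc j)) (word ix' 0 (suc j))) []   ≡⟨ lab-root _ _ ⟩
        name (leaf (depthIndex (suc j)) (word ix' 0 (suc j)))       ≡⟨ cong
            (λ z → name (leaf (depthIndex z) (word ix' 0 (suc j)))) (ℕ.+-comm 1 j) ⟩
        name (leaf (depthIndex ℓ) (word ix' 0 (suc j)))             ≡⟨ sym (lab-leaf _ origin _ len) ⟩
        lab (depthIndex ℓ) origin (ix' 0 ∷ word ix' 1 j)            ≡⟨ cong
            (λ z → lab (depthIndex ℓ) origin (ix' 0 ∷ z)) tail≡ ⟩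
        lab (depthIndex ℓ) origin (ix' 0 ∷ word ix 0 j)             ∎
        where
        open ≡-Reasoning
        up′ : up μ' ≡ 0
        up′ = first-unique (λ x → μ' (K + x)) K 0
            (trans (cong μ' (ℕ.+-identityʳ K)) (trans (sμ _) (proj₁ e-first)) , λ _ ()) z≤n
        shift : ∀ x → μ' (K + 0 + suc x) ≡ μ (K + x)
        shift x = trans (cong μ' (trans (cong (_+ suc x) (ℕ.+-identityʳ K)) (ℕ.+-suc K x))) (sμ _)
        next′ : next μ' ≡ j
        next′ = trans (cong (λ z → first (λ x → μ' (K + z + suc x)) K) up′)
          (first-unique _ K j (trans (shift j) (proj₁ j-first) , λ y y<j → trans (shift y)
              (proj₂ j-first y y<j)) j≤K)
        len : length (word ix' 0 (suc j)) ≡ D + toℕ (depthIndex ℓ)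
        len = trans (word-length ix' 0 (suc j)) (trans (ℕ.+-comm 1 j) (sym (depthIndex-correct ℓ ℓ≥D ℓ<2D)))
      go (suc e₁) refl = begin
        label μ' ix'
          ≡⟨ cong₂ (λ a b → lab (depthIndex (a + suc (down μ')))
              (leaf (depthIndex (suc b)) (word ix' a (suc b))) (word ix' 0 a)) up′ next′ ⟩
        lab (depthIndex (suc j + suc (down μ'))) (leaf (depthIndex (suc f)) (word ix' (suc j) (suc f)))
            (word ix' 0 (suc j))
          ≡⟨ cong₂ (λ a b → lab (depthIndex a) (leaf (depthIndex (suc f)) b) (word ix' 0 (suc j)))
               (trans (cong (λ z → suc j + suc z) down′) (sym (ℕ.+-suc j (suc e₁))))
               (word-cong ix' ix (suc j) j (suc f) (λ x _ → six (j + x))) ⟩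
        lab (depthIndex ℓ) origin (ix' 0 ∷ word ix' 1 j)
          ≡⟨ cong (λ z → lab (depthIndex ℓ) origin (ix' 0 ∷ z)) tail≡ ⟩
        lab (depthIndex ℓ) origin (ix' 0 ∷ word ix 0 j)
          ∎
        where
        open ≡-Reasoning
        shift : ∀ x → μ' (K + suc x) ≡ μ (K + x)
        shift x = trans (cong μ' (ℕ.+-suc K x)) (sμ _)
        up′ : up μ' ≡ suc j
        up′ = first-unique _ K (suc j) (trans (shift j) (proj₁ j-first) , below)
            (ℕ.≤-trans j<width (ℕ.<⇒≤ width<K))
          where
          below : ∀ y → y < suc j → μ' (K + y) ≡ false
          below zero    _         = trans (cong μ' (ℕ.+-identityʳ K)) (trans (sμ _) (proj₂ e-first 0 (s≤s z≤n)))
          below (suc y) (s≤s y<j) = trans (shift y) (proj₂ j-first y y<j)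
        shift↓ : ∀ x → suc x < K → μ' (K ∸ suc x) ≡ μ (K ∸ suc (suc x))
        shift↓ x lt = trans (cong μ' (ℕ.+-∸-assoc 1 (ℕ.≤-pred lt))) (sμ _)
        down′ : down μ' ≡ e₁
        down′ = first-unique _ K e₁
          (trans (shift↓ e₁ (ℕ.<⇒≤ e<K)) (proj₁ e-first)
          , λ y y<e → trans (shift↓ y (ℕ.<-trans (s≤s y<e) (ℕ.<⇒≤ e<K))) (proj₂ e-first (suc y) (s≤s y<e)))
          (ℕ.<⇒≤ (ℕ.<⇒≤ (ℕ.<⇒≤ e<K)))
        shift↑ : ∀ x → μ' (K + suc j + suc x) ≡ μ (K + j + suc x)
        shift↑ x = trans (cong (λ z → μ' (z + suc x)) (ℕ.+-suc K j)) (sμ _)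
        next′ : next μ' ≡ f
        next′ = trans (cong (λ z → first (λ x → μ' (K + z + suc x)) K) up′)
          (first-unique _ K f (trans (shift↑ f) (proj₁ f-first) , λ y y<f → trans (shift↑ y)
              (proj₂ f-first y y<f))
            (ℕ.<⇒≤ (ℕ.<-trans f<width width<K)))

    label-allowed : (μs : Fin δ → ℕ → Bool) (ixs : Fin δ → ℕ → Fin δ) →
                    (∀ c i → μs c (suc i) ≡ μ i) → (∀ c i → ixs c (suc i) ≡ ix i) → (∀ c → ixs c 0 ≡ c) →
                    AllowedUpToOrder Π (label μ ix) (λ c → label (μs c) (ixs c))
    label-allowed μs ixs sμ six top with lab-conf (depthIndex ℓ) origin (word ix 0 j) len
      where
      len : length (word ix 0 j) < D + toℕ (depthIndex ℓ)
      len = subst₂ _<_ (sym (word-length ix 0 j)) (sym (depthIndex-correct ℓ ℓ≥D ℓ<2D)) (ℕ.m<m+n j (s≤s z≤n))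
    ... | ρ , inj , sur , mem = ρ , inj , sur , subst (_∈ C) (cong₂ _,_ (sym label≡)
          (tabulate-cong (λ i → sym (trans (child-label (μs (ρ i)) (ixs (ρ i)) (sμ (ρ i)) (six (ρ i)))
             (cong (λ z → lab (depthIndex ℓ) origin (z ∷ word ix 0 j)) (top (ρ i))))))) mem

  horizon : ℕ
  horizon = K + K + suc K

  label-cong : ∀ μ μ' ix ix' → (∀ i → i ≤ horizon → μ i ≡ μ' i) → (∀ i → i ≤ horizon → ix i ≡ ix' i) →
               label μ ix ≡ label μ' ix'
  label-cong μ μ' ix ix' eμ eix = begin
    label μ ix
      ≡⟨ cong₂ (λ a b → lab (depthIndex (a + suc b))
          (leaf (depthIndex (suc (next μ))) (word ix a (suc (next μ)))) (word ix 0 a)) up′ down′ ⟩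
    lab (depthIndex (up μ' + suc (down μ'))) (leaf (depthIndex (suc (next μ)))
        (word ix (up μ') (suc (next μ)))) (word ix 0 (up μ'))
      ≡⟨ cong₂ (λ a b → lab (depthIndex (up μ' + suc (down μ')))
          (leaf (depthIndex (suc a)) (word ix (up μ') (suc a))) b) next′
           (word-cong ix ix' 0 0 (up μ') (λ x x<u → eix x
               (ℕ.≤-trans (ℕ.<⇒≤ (ℕ.<-≤-trans x<u upK)) (ℕ.≤-trans (ℕ.m≤m+n K K) (ℕ.m≤m+n (K + K) (suc K)))))) ⟩
    lab (depthIndex (up μ' + suc (down μ'))) (leaf (depthIndex (suc (next μ')))
        (word ix (up μ') (suc (next μ')))) (word ix' 0 (up μ'))
      ≡⟨ cong (λ a → lab (depthIndex (up μ' + suc (down μ'))) (leaf (depthIndex (suc (next μ'))) a)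
          (word ix' 0 (up μ')))
           (word-cong ix ix' (up μ') (up μ') (suc (next μ')) (λ x x<n → eix (up μ' + x)
             (ℕ.+-mono-≤ (ℕ.≤-trans upK (ℕ.m≤m+n K K))
                 (ℕ.≤-trans (ℕ.<⇒≤ x<n) (s≤s (first-≤ (λ x → μ' (K + up μ' + suc x)) K)))))) ⟩
    label μ' ix'
      ∎
    where
    open ≡-Reasoning
    upK : up μ' ≤ K
    upK = first-≤ (λ x → μ' (K + x)) K
    up′ : up μ ≡ up μ'
    up′ = first-cong _ _ K λ x x<K → eμ (K + x)
        (ℕ.≤-trans (ℕ.+-monoʳ-≤ K (ℕ.<⇒≤ x<K)) (ℕ.m≤m+n (K + K) (suc K)))
    down′ : down μ ≡ down μ'
    down′ = first-cong _ _ K λ x x<K → eμ (K ∸ suc x)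
        (ℕ.≤-trans (ℕ.m∸n≤m K (suc x)) (ℕ.≤-trans (ℕ.m≤m+n K K) (ℕ.m≤m+n (K + K) (suc K))))
    next′ : next μ ≡ next μ'
    next′ = trans (cong (λ z → first (λ x → μ (K + z + suc x)) K) up′)
      (first-cong _ _ K λ x x<K → eμ (K + up μ' + suc x) (ℕ.+-mono-≤ (ℕ.+-monoʳ-≤ K upK) (s≤s (ℕ.<⇒≤ x<K))))

  module Coloured (B B₁ : ℕ) (B≤B₁ : suc (B * 2) ^ D ≤ 2 ^ B₁) where

    open CoinTossing

    q : ℕ
    q = suc (B₁ * 2) ^ D

    colour₁ : (ℕ → Fin (2 ^ B)) → ℕ → Fin (2 ^ B₁)
    colour₁ s i = inject≤ (reduce B D s i) B≤B₁

    colour₂ : (ℕ → Fin (2 ^ B)) → ℕ → ℕ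
    colour₂ s i = toℕ (reduce B₁ D (colour₁ s) i)

    marks : (ℕ → Fin (2 ^ B)) → ℕ → Bool
    marks s = marked (colour₂ s) q

    module _ (s : ℕ → Fin (2 ^ B)) (proper : Proper D s) where

      marks-spaced : Spaced (marks s)
      marks-spaced = marked-spaced (colour₂ s)
        (λ i j lo hi eq → reduce-proper B₁ D (colour₁ s)
          (λ i j lo hi eq → reduce-proper B D s proper i j lo hi (Fin.inject≤-injective _ _ _ _ eq))
          i j lo hi (Fin.toℕ-injective eq)) q

      marks-dense : Dense (marks s)
      marks-dense i = marked-dense (colour₂ s) q i (Fin.toℕ<n _)

    -- Each of the two colour reductions looks `D` further, and marking `q` colour classes looks
    -- `q * (D + D)` further.
    window : ℕ
    window = D + (D + q * (D + D))

    marks-cong : ∀ s s' i i' → (∀ x → x ≤ window → s (i + x) ≡ s' (i' + x)) → marks s i ≡ marks s' i'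
    marks-cong s s' i i' eq = marked-cong (colour₂ s) (colour₂ s') q i i' λ x x≤ → cong toℕ
      (reduce-cong B₁ D (colour₁ s) (colour₁ s') (i + x) (i' + x) λ y y≤ → cong (λ z → inject≤ z B≤B₁)
        (reduce-cong B D s s' (i + x + y) (i' + x + y) λ z z≤ →
          trans (cong s (assoc i x y z)) (trans (eq (z + (y + x)) (ℕ.+-mono-≤ z≤ (ℕ.+-mono-≤ y≤ x≤)))
              (cong s' (sym (assoc i' x y z))))))
      where
      assoc : ∀ i x y z → i + x + y + z ≡ i + (z + (y + x))
      assoc i x y z = begin
        i + x + y + z    ≡⟨ cong (_+ z) (ℕ.+-assoc i x y) ⟩
        i + (x + y) + z  ≡⟨ ℕ.+-assoc i (x + y) z ⟩
        i + (x + y + z)  ≡⟨ cong (i +_) (ℕ.+-comm (x + y) z) ⟩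
        i + (z + (x + y)) ≡⟨ cong (λ w → i + (z + w)) (ℕ.+-comm x y) ⟩
        i + (z + (y + x)) ∎
        where open ≡-Reasoning

-- The LOCAL algorithm obtained from a certificate

ancestor-snoc : ∀ {n} (p : Fin n → Maybe (Fin n)) k {v w u} → ancestor p k v ≡ just w → p w ≡ just u →
                ancestor p (suc k) v ≡ just u
ancestor-snoc p zero    {v} refl eq with p v
ancestor-snoc p zero    {v} refl refl | just _ = refl
ancestor-snoc p (suc k) {v} anc eq with p v
... | just x = ancestor-snoc p k anc eq

-- A cycle through `v` is also a cycle through the parent of `v`; following it upward contradicts
-- that the ancestors run out.
ancestor-irrefl : ∀ {δ n} (t : RTree δ n) j v → ancestor (parent t) (suc j) v ≢ just v
ancestor-irrefl t j v = go (proj₁ (acyclic t v)) v (proj₂ (acyclic t v))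
  where
  go : ∀ k v → ancestor (parent t) k v ≡ nothing → ancestor (parent t) (suc j) v ≢ just v
  go (suc k) v ends loop with parent t v in eq
  ... | just w = go k w ends (ancestor-snoc (parent t) j loop eq)

-- Equal residues would make `suc D` divide `j ≤ D`. Hence `D + 1` extra identifiers, repeated
-- cyclically, continue every path properly beyond the root.
%-shift-≢ : ∀ D k j → 1 ≤ j → j ≤ D → k % suc D ≢ (k + j) % suc D
%-shift-≢ D k j 1≤j j≤D eq = ℕ.<⇒≱ (s≤s j≤D) (∣⇒≤ {{>-nonZero 1≤j}}
    (∣m+n∣m⇒∣n {m = a * M} (divides b lemma) (divides a refl)))
  where
  M = suc D
  a = k / M
  b = (k + j) / M
  open ≡-Reasoning
  lemma : a * M + j ≡ b * M
  lemma = ℕ.+-cancelˡ-≡ (k % M) _ _ (begin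
    k % M + (a * M + j)    ≡⟨ sym (ℕ.+-assoc (k % M) (a * M) j) ⟩
    k % M + a * M + j      ≡⟨ cong (_+ j) (sym (m≡m%n+[m/n]*n k M)) ⟩
    k + j                  ≡⟨ m≡m%n+[m/n]*n (k + j) M ⟩
    (k + j) % M + b * M    ≡⟨ cong (_+ b * M) (sym eq) ⟩
    k % M + b * M          ∎)

module LocalAlgorithm (c : ℕ) (Π : LCL) (cert : Certificate Π) (n B B₁ : ℕ)
  (n^c≤ : n ^ c + suc (suc (Certificate.d cert)) ≤ 2 ^ B)
  (B≤B₁ : suc (B * 2) ^ suc (Certificate.d cert) ≤ 2 ^ B₁) where

  open LCL Π
  open Certificate cert using (d)
  open Marks d using (D)
  open Labelling Π cert
  open Coloured B B₁ B≤B₁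

  i₀ : Fin δ
  i₀ = fromℕ< δ≥1

  -- Identifiers of fictitious ancestors above the root.
  virtual : ℕ → Fin (2 ^ B)
  virtual k = fromℕ< (ℕ.<-≤-trans (ℕ.+-monoʳ-< (n ^ c) (m%n<n k (suc D))) n^c≤)

  toℕ-virtual : ∀ k → toℕ (virtual k) ≡ n ^ c + k % suc D
  toℕ-virtual k = Fin.toℕ-fromℕ< _

  real : Fin (n ^ c) → Fin (2 ^ B)
  real x = inject≤ x (ℕ.≤-trans (ℕ.m≤m+n _ _) n^c≤)

  real≢virtual : ∀ x k → real x ≢ virtual k
  real≢virtual x k eq = ℕ.<⇒≢ (ℕ.<-≤-trans (Fin.toℕ<n x) (ℕ.m≤m+n (n ^ c) (k % suc D)))
    (trans (sym (Fin.toℕ-inject≤ x _)) (trans (cong toℕ eq) (toℕ-virtual k)))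

  -- Children are listed by identifier rather than by node: the least such list is then determined
  -- by the view, and all children of `p` agree on it.
  Enumerates : RTree δ n → IdAssign c n → Fin n → (Fin δ → Fin (n ^ c)) → Set
  Enumerates t ids p f = Injective f
    × (∀ i → ∃ λ w → parent t w ≡ just p × proj₁ ids w ≡ f i)
    × (∀ w → parent t w ≡ just p → ∃ λ i → f i ≡ proj₁ ids w)

  enumerates? : ∀ t ids p f → Dec (Enumerates t ids p f)
  enumerates? t ids p f = injective? f
    ×-dec Fin.all? (λ i → Fin.any? λ w → ≡-dec Fin._≟_ (parent t w) (just p) ×-dec (proj₁ ids w Fin.≟ f i))
    ×-dec Fin.all? (λ w → ≡-dec Fin._≟_ (parent t w) (just p) →-dec Fin.any? λ i → f i Fin.≟ proj₁ ids w)

  childOrder : RTree δ n → IdAssign c n → Fin n → Maybe (Fin ((n ^ c) ^ δ))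
  childOrder t ids p = least (λ x → enumerates? t ids p (finToFun x))

  locate : Fin (n ^ c) → Maybe (Fin ((n ^ c) ^ δ)) → Fin δ
  locate a nothing  = i₀
  locate a (just x) = maybe′ (λ i → i) i₀ (least (λ i → finToFun {n ^ c} {δ} x i Fin.≟ a))

  childIndex : RTree δ n → IdAssign c n → Fin n → Fin δ
  childIndex t ids v = maybe′ (λ p → locate (proj₁ ids v) (childOrder t ids p)) i₀ (parent t v)

  idStream : RTree δ n → IdAssign c n → Fin n → ℕ → Fin (2 ^ B)
  idStream t ids v zero    = real (proj₁ ids v)
  idStream t ids v (suc k) = maybe′ (λ w → idStream t ids w k) (virtual k) (parent t v)

  ixStream : RTree δ n → IdAssign c n → Fin n → ℕ → Fin δ
  ixStream t ids v zero    = childIndex t ids v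
  -- Beyond the root any fixed index serves, since the labelling only requires that the streams of a
  -- node and of its children fit together.
  ixStream t ids v (suc k) = maybe′ (λ w → ixStream t ids w k) i₀ (parent t v)

  algorithm : LocalAlg c Π n
  algorithm t ids v = label (marks (idStream t ids v)) (ixStream t ids v)

  idStream-fresh : ∀ t (ids : IdAssign c n) v x → (∀ j w → ancestor (parent t) j v ≡ just w → proj₁ ids w ≢ x) →
                   ∀ k → real x ≢ idStream t ids v k
  idStream-fresh t ids v x fresh zero    eq = fresh 0 v refl (sym (Fin.inject≤-injective _ _ _ _ eq))
  idStream-fresh t ids v x fresh (suc k) eq with parent t v in pv
  ... | nothing = real≢virtual x k eq
  ... | just w  = idStream-fresh t ids w x (λ j u anc → fresh (suc j) u (lift j anc)) k eq
    where
    lift : ∀ j {u} → ancestor (parent t) j w ≡ just u → ancestor (parent t) (suc j) v ≡ just u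
    lift j anc rewrite pv = anc

  -- Real identifiers of different ancestors differ by acyclicity, real and virtual ones occupy
  -- disjoint ranges, and virtual ones have period `D + 1`.
  idStream-proper : ∀ t ids v → Proper D (idStream t ids v)
  idStream-proper t ids v zero (suc j) _ _ eq with parent t v in pv
  ... | nothing = real≢virtual _ j eq
  ... | just w  = idStream-fresh t ids w _ fresh j eq
    where
    fresh : ∀ j u → ancestor (parent t) j w ≡ just u → proj₁ ids u ≢ proj₁ ids v
    fresh j u anc e = ancestor-irrefl t j v (trans (anc′ anc) (cong just (proj₂ ids e)))
      where
      anc′ : ancestor (parent t) j w ≡ just u → ancestor (parent t) (suc j) v ≡ just u
      anc′ a rewrite pv = a
  idStream-proper t ids v (suc i) j lo hi eq with parent t v
  ... | nothing = %-shift-≢ D i j lo hi (ℕ.+-cancelˡ-≡ (n ^ c) _ _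
        (trans (sym (toℕ-virtual i)) (trans (cong toℕ eq) (toℕ-virtual (i + j)))))
  ... | just w  = idStream-proper t ids w i j lo hi eq

  module _ (t : RTree δ n) (ids : IdAssign c n) (v : Fin n) where

    idStream-child : ∀ {u} → parent t u ≡ just v → ∀ k → idStream t ids u (suc k) ≡ idStream t ids v k
    idStream-child pu k rewrite pu = refl

    ixStream-child : ∀ {u} → parent t u ≡ just v → ∀ k → ixStream t ids u (suc k) ≡ ixStream t ids v k
    ixStream-child pu k rewrite pu = refl

    childOrder-exists : ChildEnum (parent t) δ v → ∃ λ x → childOrder t ids v ≡ just x × Enumerates t ids v
        (finToFun x)
    childOrder-exists (e , inj , par , sur) with least-complete
        (λ x → enumerates? t ids v (finToFun x)) {funToFin f}
        ((λ {x} {y} eq → inj (proj₂ ids (trans (sym (ff x)) (trans eq (ff y)))))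
        , (λ i → e i , par i , sym (ff i))
        , λ w pw → proj₁ (sur w pw) , trans (ff _) (cong (proj₁ ids) (proj₂ (sur w pw))))
      where
      f : Fin δ → Fin (n ^ c)
      f i = proj₁ ids (e i)
      ff : ∀ i → finToFun (funToFin f) i ≡ f i
      ff = Fin.finToFun-funToFin f
    ... | x , eq = x , eq , least-sound (λ x → enumerates? t ids v (finToFun x)) eq

    locate-correct : ∀ x → Injective (finToFun {n ^ c} {δ} x) → ∀ i → locate (finToFun x i) (just x) ≡ i
    locate-correct x inj i with least-complete (λ k → finToFun {n ^ c} {δ} x k Fin.≟ finToFun x i) {i} refl
    ... | k , eq rewrite eq = inj (least-sound (λ k → finToFun {n ^ c} {δ} x k Fin.≟ finToFun x i) eq)

    childIndex-correct : ∀ x → childOrder t ids v ≡ just x → Injective (finToFun {n ^ c} {δ} x) →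
                         ∀ u i → parent t u ≡ just v → proj₁ ids u ≡ finToFun x i → childIndex t ids u ≡ i
    childIndex-correct x ord inj u i pu idu rewrite pu | ord | idu = locate-correct x inj i

    allowed⇒feasible : ∀ x → (en : Enumerates t ids v (finToFun x)) (ℓ : Fin n → Fin g) →
      AllowedUpToOrder Π (ℓ v) (λ i → ℓ (proj₁ (proj₁ (proj₂ en) i))) →
      Σ (ChildEnum (parent t) δ v) λ e → (ℓ v , tabulate (λ i → ℓ (proj₁ e i))) ∈ C
    allowed⇒feasible x (inj , child , every) ℓ (ρ , ρ-inj , ρ-sur , mem) =
      ( (λ i → proj₁ (child (ρ i)))
      , (λ {i} {j} eq → ρ-inj (inj (trans (sym (proj₂ (proj₂ (child (ρ i)))))
                                     (trans (cong (proj₁ ids) eq) (proj₂ (proj₂ (child (ρ j))))))))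
      , (λ i → proj₁ (proj₂ (child (ρ i))))
      , λ w pw → let k , fk = every w pw ; j , ρj = ρ-sur k in
          j , proj₂ ids (trans (proj₂ (proj₂ (child (ρ j)))) (trans (cong (finToFun x) ρj) fk)) )
      , mem

    algorithm-feasible-at : ChildEnum (parent t) δ v → Σ (ChildEnum (parent t) δ v) λ e →
      (algorithm t ids v , tabulate (λ i → algorithm t ids (proj₁ e i))) ∈ C
    algorithm-feasible-at ce with childOrder-exists ce
    ... | x , ord , en@(inj , child , _) = allowed⇒feasible x en (algorithm t ids)
      (label-allowed (marks (idStream t ids v)) (ixStream t ids v)
        (position (marks (idStream t ids v)) (marks-spaced (idStream t ids v) (idStream-proper t ids v))
          (marks-dense (idStream t ids v) (idStream-proper t ids v)))
        (λ i → marks (idStream t ids (proj₁ (child i)))) (λ i → ixStream t ids (proj₁ (child i)))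
        (λ i k → marks-cong (idStream t ids (proj₁ (child i))) (idStream t ids v) (suc k) k
          λ y _ → idStream-child (proj₁ (proj₂ (child i))) (k + y))
        (λ i → ixStream-child (proj₁ (proj₂ (child i))))
        (λ i → childIndex-correct x ord inj (proj₁ (child i)) i (proj₁ (proj₂ (child i)))
            (proj₂ (proj₂ (child i)))))

  -- The two extra steps serve `childIndex`: one to the parent, and one down to the siblings, whose
  -- identifiers fix the order.
  radius : ℕ
  radius = suc (suc (horizon + window))

  module _ {t t' : RTree δ n} {ids ids' : IdAssign c n} {v v' : Fin n}
           (view : LocalView {c = c} radius t ids v t' ids' v') where

    private
      π = proj₁ view
    open Inverse π

    private
      πv : to v ≡ v'
      πv = proj₁ (proj₂ view)
      iso : ViewIso t t' (InBall t radius v) (InBall t' radius v') π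
      iso = proj₁ (proj₂ (proj₂ view))
      iso⁻¹ : ViewIso t' t (InBall t' radius v') (InBall t radius v) (↔-sym π)
      iso⁻¹ = viewIso-sym {t = t} {t' = t'} {R = InBall t radius v} {R' = InBall t' radius v'} π iso

      image : ∀ {a w} → a ≤ radius → Reach t a v w → Reach t' a v' (to w)
      image {a} {w} a≤ r = subst (λ z → Reach t' a z (to w)) πv
        (viewIso-reach (InBall t radius v) (InBall t' radius v') π iso (λ r → r) {b = 0} here a≤ r)

      parent-image : ∀ {a w p} → Reach t a v w → suc a ≤ radius → parent t w ≡ just p → parent t' (to w)
          ≡ just (to p)
      parent-image {w = w} {p} r le pw = Equivalence.to
          (proj₂ iso w p (reach-≤ (ℕ.<⇒≤ le) r) (reach-≤ le (reach-snoc r (inj₁ pw)))) pw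

      child-image : ∀ {a w p} → Reach t a v p → suc a ≤ radius → parent t w ≡ just p → parent t' (to w)
          ≡ just (to p)
      child-image {w = w} {p} r le pw = Equivalence.to
          (proj₂ iso w p (reach-≤ le (reach-snoc r (inj₂ pw))) (reach-≤ (ℕ.<⇒≤ le) r)) pw

      parent-preimage : ∀ {a w p'} → Reach t a v w → suc a ≤ radius → parent t' (to w)
          ≡ just p' → parent t w ≡ just (from p')
      parent-preimage {w = w} {p'} r le pw = subst (λ z → parent t z ≡ just (from p')) (strictlyInverseʳ w)
        (Equivalence.to (proj₂ iso⁻¹ (to w) p' (reach-≤ (ℕ.<⇒≤ le) r')
            (reach-≤ le (reach-snoc r' (inj₁ pw)))) pw)
        where r' = image (ℕ.<⇒≤ le) r

      child-preimage : ∀ {a w' p} → Reach t a v p → suc a ≤ radius → parent t' w' ≡ just (to p) → parent t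
          (from w') ≡ just p
      child-preimage {w' = w'} {p} r le pw = subst (λ z → parent t (from w') ≡ just z) (strictlyInverseʳ p)
        (Equivalence.to (proj₂ iso⁻¹ w' (to p) (reach-≤ le (reach-snoc r' (inj₂ pw)))
            (reach-≤ (ℕ.<⇒≤ le) r')) pw)
        where r' = image (ℕ.<⇒≤ le) r

      parent-map : ∀ {a w} → Reach t a v w → suc a ≤ radius → parent t' (to w) ≡ Maybe.map to (parent t w)
      parent-map {w = w} r le with parent t w in pw
      ... | just p = parent-image r le pw
      -- A missing parent transfers too: a parent of the image would lie inside the ball and pull
      -- back.
      ... | nothing with parent t' (to w) in pw'
      ...   | nothing = refl
      ...   | just p' = contradiction (trans (sym pw) (parent-preimage r le pw')) λ ()

      id-map : ∀ {a w} → Reach t a v w → a ≤ radius → proj₁ ids' (to w) ≡ proj₁ ids w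
      id-map {w = w} r le = proj₂ (proj₂ (proj₂ view)) w (reach-≤ le r)

      enumerates-view : ∀ {a p} → Reach t a v p → suc a
          ≤ radius → ∀ f → Enumerates t ids p f ⇔ Enumerates t' ids' (to p) f
      enumerates-view {a} {p} r le f = mk⇔ fwd bwd
        where
        fwd : Enumerates t ids p f → Enumerates t' ids' (to p) f
        fwd (inj , child , every) = inj
          , (λ i → let w , pw , e = child i in to w , child-image r le pw , trans (id-map (reach-snoc r (inj₂ pw)) le) e)
          , λ w' pw' → let pw = child-preimage r le pw' ; i , e = every (from w') pw in
              i , trans e (trans (sym (id-map (reach-snoc r (inj₂ pw)) le))
                  (cong (proj₁ ids') (strictlyInverseˡ w')))
        bwd : Enumerates t' ids' (to p) f → Enumerates t ids p f
        bwd (inj , child , every) = inj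
          , (λ i → let w' , pw' , e = child i ; pw = child-preimage r le pw' in
               from w' , pw , trans (sym (id-map (reach-snoc r (inj₂ pw)) le))
                   (trans (cong (proj₁ ids') (strictlyInverseˡ w')) e))
          , λ w pw → let i , e = every (to w) (child-image r le pw) in i , trans e (id-map (reach-snoc r (inj₂ pw)) le)

      childIndex-view : ∀ {a w} → Reach t a v w → suc (suc a) ≤ radius → childIndex t ids w
          ≡ childIndex t' ids' (to w)
      childIndex-view {w = w} r le
        rewrite parent-map r (ℕ.<⇒≤ le) | id-map r (ℕ.<⇒≤ (ℕ.<⇒≤ le)) with parent t w in pw
      ... | nothing = refl
      ... | just p  = cong (locate (proj₁ ids w)) (least-cong
              (λ x → enumerates? t ids p (finToFun x)) (λ x → enumerates? t' ids' (to p) (finToFun x))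
              (λ x → enumerates-view (reach-snoc r (inj₁ pw)) le (finToFun x)))

      streams-view : ∀ k {a w} → Reach t a v w → suc (suc (k + a)) ≤ radius →
                     idStream t ids w k ≡ idStream t' ids' (to w) k × ixStream t ids w k ≡ ixStream t' ids'
                         (to w) k
      streams-view zero    r le = cong real (sym (id-map r (ℕ.<⇒≤ (ℕ.<⇒≤ le)))) , childIndex-view r le
      streams-view (suc k) {a} {w} r le
        rewrite parent-map r (ℕ.≤-trans (s≤s (ℕ.≤-trans (ℕ.m≤n+m a (suc k))
            (ℕ.n≤1+n _))) le) with parent t w in pw
      ... | nothing = refl , refl
      ... | just p  = streams-view k (reach-snoc r (inj₁ pw))
          (subst (λ z → suc (suc z) ≤ radius) (sym (ℕ.+-suc k a)) le)

      streams-agree : ∀ k → k ≤ horizon + window → idStream t ids v k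
          ≡ idStream t' ids' v' k × ixStream t ids v k ≡ ixStream t' ids' v' k
      streams-agree k k≤ = subst (λ z → idStream t ids v k ≡ idStream t' ids' z k × ixStream t ids v k
          ≡ ixStream t' ids' z k) πv
        (streams-view k {0} here (s≤s (s≤s (subst (_≤ horizon + window) (sym (ℕ.+-identityʳ k)) k≤))))

    algorithm-view : algorithm t ids v ≡ algorithm t' ids' v'
    algorithm-view = label-cong (marks (idStream t ids v)) (marks (idStream t' ids' v')) (ixStream t ids v)
        (ixStream t' ids' v')
      (λ i i≤ → marks-cong (idStream t ids v) (idStream t' ids' v') i i λ x x≤ → proj₁
          (streams-agree (i + x) (ℕ.+-mono-≤ i≤ x≤)))
      (λ i i≤ → proj₂ (streams-agree i (ℕ.≤-trans i≤ (ℕ.m≤m+n horizon window))))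

  solves : SolvesLOCAL c Π n radius
  solves = algorithm
    , (λ t ids v t' ids' v' view → algorithm-view {t} {t'} {ids} {ids'} {v} {v'} view)
    , λ t ids v ce → algorithm-feasible-at t ids v ce

-- Sizes of regular trees

sumFin : ∀ {k} → (Fin k → ℕ) → ℕ
sumFin {zero}  d = 0
sumFin {suc k} d = d zero + sumFin (d ∘ suc)

splitSum : ∀ {k} (d : Fin k → ℕ) → Fin (sumFin d) → Σ (Fin k) (Fin ∘ d)
splitSum {suc k} d x = [ (λ i → zero , i) , (λ y → let v , i = splitSum (d ∘ suc) y in suc v , i) ]′ (splitAt (d zero) x)

joinSum : ∀ {k} (d : Fin k → ℕ) → Σ (Fin k) (Fin ∘ d) → Fin (sumFin d)
joinSum {suc k} d (zero  , i) = i ↑ˡ sumFin (d ∘ suc)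
joinSum {suc k} d (suc v , i) = d zero ↑ʳ joinSum (d ∘ suc) (v , i)

splitSum-joinSum : ∀ {k} (d : Fin k → ℕ) p → splitSum d (joinSum d p) ≡ p
splitSum-joinSum {suc k} d (zero  , i) rewrite Fin.splitAt-↑ˡ (d zero) i (sumFin (d ∘ suc)) = refl
splitSum-joinSum {suc k} d (suc v , i)
  rewrite Fin.splitAt-↑ʳ (d zero) (sumFin (d ∘ suc)) (joinSum (d ∘ suc) (v , i)) | splitSum-joinSum
      (d ∘ suc) (v , i) = refl

joinSum-splitSum : ∀ {k} (d : Fin k → ℕ) x → joinSum d (splitSum d x) ≡ x
joinSum-splitSum {suc k} d x with splitAt (d zero) x in eq
... | inj₁ i = Fin.splitAt⁻¹-↑ˡ eq
... | inj₂ y = trans (cong (d zero ↑ʳ_) (joinSum-splitSum (d ∘ suc) y)) (Fin.splitAt⁻¹-↑ʳ eq)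

sumFin-multiple : ∀ {k} (d : Fin k → ℕ) δ → (∀ v → d v ≡ 0 ⊎ d v ≡ δ) → ∃ λ m → sumFin d ≡ m * δ
sumFin-multiple {zero}  d δ h = 0 , refl
sumFin-multiple {suc k} d δ h with sumFin-multiple (d ∘ suc) δ (h ∘ suc) | h zero
... | m , eq | inj₁ z rewrite z | eq = m , refl
... | m , eq | inj₂ s rewrite s | eq = suc m , refl

module _ {δ n : ℕ} (t : RTree δ n) where

  private
    degree : ∀ {v} → IsLeaf (parent t) v ⊎ ChildEnum (parent t) δ v → ℕ
    degree (inj₁ _) = 0
    degree (inj₂ _) = δ

    kid : ∀ {v} (r : IsLeaf (parent t) v ⊎ ChildEnum (parent t) δ v) → Fin (degree r) → Fin n
    kid (inj₂ (e , _)) = e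

    kid-parent : ∀ {v} r i → parent t (kid {v} r i) ≡ just v
    kid-parent (inj₂ (_ , _ , par , _)) = par

    kid-injective : ∀ {v} r i j → kid {v} r i ≡ kid r j → i ≡ j
    kid-injective (inj₂ (_ , inj , _)) i j = inj

    kid-surjective : ∀ {v} r u → parent t u ≡ just v → ∃ λ i → kid {v} r i ≡ u
    kid-surjective (inj₁ isLeaf)        u pu = contradiction pu (isLeaf u)
    kid-surjective (inj₂ (_ , _ , _ , sur)) u pu = sur u pu

    d : Fin n → ℕ
    d v = degree (regular t v)

    slot : Σ (Fin n) (Fin ∘ d) → Fin n
    slot (v , i) = kid (regular t v) i

    slot-injective : ∀ p q → slot p ≡ slot q → p ≡ q
    slot-injective (v , i) (w , j) eq
      with just-injective (trans (sym (kid-parent (regular t v) i))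
          (trans (cong (parent t) eq) (kid-parent (regular t w) j)))
    ... | refl = cong (v ,_) (kid-injective (regular t v) i j eq)

    enum : Fin (suc (sumFin d)) → Fin n
    enum zero    = root t
    enum (suc x) = slot (splitSum d x)

    enum-injective : Injective enum
    enum-injective {zero}  {zero}  eq = refl
    enum-injective {zero}  {suc y} eq with splitSum d y
    ... | w , j = contradiction (trans (sym (root-top t))
        (trans (cong (parent t) eq) (kid-parent (regular t w) j))) λ ()
    enum-injective {suc x} {zero}  eq with splitSum d x
    ... | w , j = contradiction (trans (sym (root-top t))
        (trans (cong (parent t) (sym eq)) (kid-parent (regular t w) j))) λ ()
    enum-injective {suc x} {suc y} eq = cong suc (trans (sym (joinSum-splitSum d x))
      (trans (cong (joinSum d) (slot-injective _ _ eq)) (joinSum-splitSum d y)))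

    enum-surjective : ∀ u → ∃ λ x → enum x ≡ u
    enum-surjective u with parent t u in pu
    ... | nothing = zero , sym (uniqueRt t u pu)
    ... | just v with kid-surjective (regular t v) u pu
    ...   | i , eq = suc (joinSum d (v , i)) , trans (cong slot (splitSum-joinSum d (v , i))) eq

  -- The root together with the `δ` child slots of every internal node lists each node exactly once.
  -- So every `n` that admits an instance is the size of a heap, and the adversary may play on the
  -- heap.
  size≡1+multiple : ∃ λ m → n ≡ suc (m * δ)
  size≡1+multiple with sumFin-multiple d δ deg
    where
    deg : ∀ v → d v ≡ 0 ⊎ d v ≡ δ
    deg v with regular t v
    ... | inj₁ _ = inj₁ refl
    ... | inj₂ _ = inj₂ refl
  ... | m , eq = m , trans (ℕ.≤-antisym n≤ ≤n) (cong suc eq)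
    where
    ≤n : suc (sumFin d) ≤ n
    ≤n = Fin.injective⇒≤ enum-injective
    n≤ : n ≤ suc (sumFin d)
    n≤ = Fin.injective⇒≤ {f = λ u → proj₁ (enum-surjective u)} λ {u} {w} eq →
      trans (sym (proj₂ (enum-surjective u))) (trans (cong enum eq) (proj₂ (enum-surjective w)))

-- Heap-shaped trees, permutations and words as addresses

-- Nodes are numbered in breadth-first order, so every initial segment of length 1 + mδ is a tree.
module Heap (δ : ℕ) {{_ : NonZero δ}} where

  child : ℕ → Fin δ → ℕ
  child a i = suc (toℕ i + a * δ)

  child-injective : ∀ {a b i j} → child a i ≡ child b j → a ≡ b × i ≡ j
  child-injective {a} {b} {i} {j} eq = ℕ.*-cancelʳ-≡ a b δ
      (ℕ.+-cancelˡ-≡ (toℕ i) _ _ (trans (ℕ.suc-injective eq) (cong (λ z → toℕ z + b * δ) (sym i≡j)))) , i≡j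
    where
    rem : ∀ a (i : Fin δ) → (toℕ i + a * δ) % δ ≡ toℕ i
    rem a i = trans ([m+kn]%n≡m%n (toℕ i) a δ) (m<n⇒m%n≡m (Fin.toℕ<n i))
    i≡j : i ≡ j
    i≡j = Fin.toℕ-injective (trans (sym (rem a i)) (trans (cong (_% δ) (ℕ.suc-injective eq)) (rem b j)))

  a<child : ∀ a i → a < child a i
  a<child a i = s≤s (ℕ.≤-trans (ℕ.m≤m*n a δ) (ℕ.m≤n+m (a * δ) (toℕ i)))

  module _ (m : ℕ) where

    size : ℕ
    size = suc (m * δ)

    quotient< : ∀ (x : Fin (m * δ)) → toℕ x / δ < size
    quotient< x = s≤s (ℕ.≤-trans (m/n≤m (toℕ x) δ) (ℕ.<⇒≤ (Fin.toℕ<n x)))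

    heapParent : Fin size → Maybe (Fin size)
    heapParent zero    = nothing
    heapParent (suc x) = just (fromℕ< (quotient< x))

    parent⇒child : ∀ {u p} → heapParent u ≡ just p → ∃ λ i → toℕ u ≡ child (toℕ p) i
    parent⇒child {suc x} refl = fromℕ< (m%n<n (toℕ x) δ) , cong suc (trans (m≡m%n+[m/n]*n (toℕ x) δ)
      (cong₂ (λ a b → a + b * δ) (sym (Fin.toℕ-fromℕ< (m%n<n (toℕ x) δ))) (sym (Fin.toℕ-fromℕ< (quotient< x)))))

    child⇒parent : ∀ {u p} i → toℕ u ≡ child (toℕ p) i → heapParent u ≡ just p
    child⇒parent {suc x} {p} i eq with parent⇒child {suc x} refl
    ... | j , eq′ = cong just (Fin.toℕ-injective (proj₁ (child-injective (trans (sym eq′) eq))))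

    heapAncestor : ∀ k v → toℕ v < k → ancestor heapParent k v ≡ nothing
    heapAncestor (suc k) zero    _         = refl
    heapAncestor (suc k) (suc x) (s≤s x<k) = heapAncestor k _
      (ℕ.≤-<-trans (ℕ.≤-reflexive (Fin.toℕ-fromℕ< (quotient< x))) (ℕ.≤-<-trans (m/n≤m (toℕ x) δ) x<k))

    child< : ∀ a i → a < m → child a i < size
    child< a i a<m = s≤s (ℕ.<-≤-trans (ℕ.+-monoˡ-< (a * δ) (Fin.toℕ<n i)) (ℕ.*-monoˡ-≤ δ a<m))

    child<⇒internal : ∀ a i → child a i < size → a < m
    child<⇒internal a i (s≤s lt) = ℕ.*-cancelʳ-< δ a m (ℕ.≤-<-trans (ℕ.m≤n+m (a * δ) (toℕ i)) lt)

    heapChildren : ∀ v → toℕ v < m → ChildEnum heapParent δ v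
    heapChildren v v<m = e , inj , (λ i → child⇒parent i (toℕe i)) , sur
      where
      e : Fin δ → Fin size
      e i = fromℕ< (child< (toℕ v) i v<m)
      toℕe : ∀ i → toℕ (e i) ≡ child (toℕ v) i
      toℕe i = Fin.toℕ-fromℕ< (child< (toℕ v) i v<m)
      inj : Injective e
      inj {i} {j} eq = proj₂ (child-injective {toℕ v} {toℕ v}
          (trans (sym (toℕe i)) (trans (cong toℕ eq) (toℕe j))))
      sur : ∀ u → heapParent u ≡ just v → ∃ λ i → e i ≡ u
      sur u pu with parent⇒child pu
      ... | i , eq = i , Fin.toℕ-injective (trans (toℕe i) (sym eq))

    heap : RTree δ size
    heap = record
      { parent   = heapParent
      ; root     = zero
      ; root-top = refl
      ; uniqueRt = λ { zero _ → refl }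
      ; acyclic  = λ v → suc (toℕ v) , heapAncestor (suc (toℕ v)) v ℕ.≤-refl
      ; regular  = reg
      }
      where
      reg : ∀ v → IsLeaf heapParent v ⊎ ChildEnum heapParent δ v
      reg v with toℕ v ℕ.<? m
      ... | yes v<m = inj₂ (heapChildren v v<m)
      ... | no v≮m  = inj₁ λ u pu → let i , eq = parent⇒child pu in
              v≮m (child<⇒internal (toℕ v) i (subst (_< size) eq (Fin.toℕ<n u)))

swap-eq : ∀ {n} (i j : Fin n) → swap i j i ≡ j
swap-eq i j with i Fin.≟ i
... | yes _ = refl
... | no ¬p = contradiction refl ¬p

swap-other : ∀ {n} (i j k : Fin n) → k ≢ i → k ≢ j → swap i j k ≡ k
swap-other i j k k≢i k≢j with k Fin.≟ i
... | yes e = contradiction e k≢i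
... | no _ with k Fin.≟ j
...   | yes e = contradiction e k≢j
...   | no _  = refl

swap-refl : ∀ {n} (i k : Fin n) → swap i i k ≡ k
swap-refl i k with k Fin.≟ i
... | yes e = sym e
... | no ne with k Fin.≟ i
...   | yes e = contradiction e ne
...   | no _  = refl

module _ {n : ℕ} {A : Set} (f f' : A → Fin n) where

  abstract

    -- The equivalence says that `f a ↦ f' a` is well defined and injective, which leaves room for
    -- repetitions in the list. Each new point is corrected by one transposition, which fixes the
    -- images already settled.
    extendToPermutation : (as : List A) → (∀ {a b} → a ∈ as → b ∈ as → f a ≡ f b ⇔ f' a ≡ f' b) →
                          Σ (Fin n ↔ Fin n) λ π → ∀ {a} → a ∈ as → Inverse.to π (f a) ≡ f' a
    extendToPermutation []       eqv = Perm.id , λ ()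
    extendToPermutation (a ∷ as) eqv with extendToPermutation as (λ p q → eqv (there p) (there q))
    ... | π , π-as = π ∘ₚ transpose (to (f a)) (f' a) ,
        λ { (here refl) → swap-eq (to (f a)) (f' a) ; (there p) → old p }
      where
      open Inverse π
      old : ∀ {b} → b ∈ as → swap (to (f a)) (f' a) (to (f b)) ≡ f' b
      old {b} p with f a Fin.≟ f b
      ... | yes e = trans (cong (λ z → swap z (f' a) (to (f b))) (trans (cong to e) (trans (π-as p) (sym e'))))
                      (trans (swap-refl (f' a) (to (f b))) (π-as p))
        where
        e' : f' a ≡ f' b
        e' = Equivalence.to (eqv (here refl) (there p)) e
      ... | no ne = trans (swap-other _ _ _ (λ e → ne (sym (to-injective π e)))
                      (λ e → ne (Equivalence.from (eqv (here refl) (there p)) (trans (sym e) (π-as p)))))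
                          (π-as p)

words≤ : ∀ δ → ℕ → List (List (Fin δ))
words≤ δ zero    = [] ∷ []
words≤ δ (suc k) = [] ∷ cartesianProductWith _∷_ (allFin δ) (words≤ δ k)

∈-words≤ : ∀ {δ} k (w : List (Fin δ)) → length w ≤ k → w ∈ words≤ δ k
∈-words≤ zero    []      _        = here refl
∈-words≤ (suc k) []      _        = here refl
∈-words≤ (suc k) (i ∷ w) (s≤s le) = there (∈-cartesianProductWith⁺ _∷_ (∈-allFin i) (∈-words≤ k w le))

words≤-length : ∀ {δ} k {w : List (Fin δ)} → w ∈ words≤ δ k → length w ≤ k
words≤-length zero    (here refl) = z≤n
words≤-length (suc k) (here refl) = z≤n
words≤-length {δ} (suc k) (there p)
  with ∈-cartesianProductWith⁻ _∷_ (allFin δ) (words≤ δ k) p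
... | i , w , _ , q , refl = s≤s (words≤-length k q)

decode : ∀ {δ} k → Fin (δ ^ k) → List (Fin δ)
decode         zero    _ = []
decode {δ}     (suc k) x = proj₁ (remQuot {δ} (δ ^ k) x) ∷ decode k (proj₂ (remQuot {δ} (δ ^ k) x))

encode : ∀ {δ} → Fin δ → ∀ k → List (Fin δ) → Fin (δ ^ k)
encode i₀ zero    _       = zero
encode i₀ (suc k) []      = combine i₀ (encode i₀ k [])
encode i₀ (suc k) (i ∷ w) = combine i (encode i₀ k w)

decode-length : ∀ {δ} k (x : Fin (δ ^ k)) → length (decode k x) ≡ k
decode-length zero    x = refl
decode-length (suc k) x = cong suc (decode-length k _)

decode-encode : ∀ {δ} (i₀ : Fin δ) k w → length w ≡ k → decode k (encode i₀ k w) ≡ w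
decode-encode i₀ zero    []      eq = refl
decode-encode {δ} i₀ (suc k) (i ∷ w) eq = cong₂ _∷_ (cong proj₁ rq)
    (trans (cong (decode k ∘ proj₂) rq) (decode-encode i₀ k w (ℕ.suc-injective eq)))
  where
  rq : remQuot {δ} (δ ^ k) (combine i (encode i₀ k w)) ≡ (i , encode i₀ k w)
  rq = Fin.remQuot-combine {δ} {δ ^ k} i (encode i₀ k w)

encode-decode : ∀ {δ} (i₀ : Fin δ) k x → encode i₀ k (decode k x) ≡ x
encode-decode i₀ zero    zero = refl
encode-decode {δ} i₀ (suc k) x =
  trans (cong (combine (proj₁ (remQuot {δ} (δ ^ k) x))) (encode-decode i₀ k _))
      (Fin.combine-remQuot {δ} (δ ^ k) x)

module Descend (δ : ℕ) {{_ : NonZero δ}} where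

  open Heap δ

  descend : ℕ → List (Fin δ) → ℕ
  descend v []      = v
  descend v (i ∷ w) = child (descend v w) i

  descend-++ : ∀ v w u → descend v (w ++ u) ≡ descend (descend v u) w
  descend-++ v []      u = refl
  descend-++ v (i ∷ w) u = cong (λ z → child z i) (descend-++ v w u)

-- Placements of clusters and the online adversary

-- The adversary first asks for all depth-T descendants of N cluster roots whose depth-(2T+1)
-- subtrees are disjoint; what is revealed then is just N copies of the complete tree of
-- depth 2T, wherever the clusters are placed.
module Clusters (Π : LCL) {{_ : NonZero (LCL.δ Π)}} (T m : ℕ)
  (A : OnlineAlg Π (Heap.size (LCL.δ Π) m)) (loc : HasLocalityOnline Π (Heap.size (LCL.δ Π) m) T A)
      (N : ℕ) where

  open LCL Π
  open Heap δ
  open Descend δ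

  n : ℕ
  n = size m

  t : RTree δ n
  t = heap m

  i₀ : Fin δ
  i₀ = fromℕ< δ≥1

  abstract

    -- Makes descent on natural numbers total, so that bounds are needed only where a position is
    -- actually read.
    clip : ℕ → Fin n
    clip a = a mod n

    toℕ-clip : ∀ {a} → a < n → toℕ (clip a) ≡ a
    toℕ-clip {a} a<n = trans (Fin.toℕ-fromℕ< (m%n<n a n)) (m<n⇒m%n≡m a<n)

  clip-toℕ : ∀ {a} (u : Fin n) → toℕ u ≡ a → u ≡ clip a
  clip-toℕ u refl = Fin.toℕ-injective (sym (toℕ-clip (Fin.toℕ<n u)))

  -- Balls around depth-`T` nodes reach depth `2T`. One more level must be separated, so that a
  -- child of a revealed node is never a revealed node of another cluster.
  record Placement : Set where
    field
      pos       : Fin N → ℕ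
      bounded   : ∀ k w → length w ≤ suc (T + T) → descend (pos k) w < n
      separated : ∀ k k' w w' → length w ≤ suc (T + T) → length w' ≤ suc (T + T) →
                  descend (pos k) w ≡ descend (pos k') w' → k ≡ k' × w ≡ w'

    at : Fin N → List (Fin δ) → Fin n
    at k w = clip (descend (pos k) w)

    toℕ-at : ∀ k w → length w ≤ suc (T + T) → toℕ (at k w) ≡ descend (pos k) w
    toℕ-at k w le = toℕ-clip (bounded k w le)

    at-injective : ∀ k k' w w' → length w ≤ suc (T + T) → length w' ≤ suc (T + T) → at k w ≡ at k' w' → k
        ≡ k' × w ≡ w'
    at-injective k k' w w' le le' eq =
      separated k k' w w' le le' (trans (sym (toℕ-at k w le)) (trans (cong toℕ eq) (toℕ-at k' w' le')))

    at-parent : ∀ k i w → length (i ∷ w) ≤ suc (T + T) → parent t (at k (i ∷ w)) ≡ just (at k w)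
    at-parent k i w le = child⇒parent m i
      (trans (toℕ-at k (i ∷ w) le) (cong (λ z → child z i) (sym (toℕ-at k w (ℕ.≤-trans (ℕ.n≤1+n _) le)))))

    at-child : ∀ {u} k w → length w ≤ T + T → parent t u ≡ just (at k w) → ∃ λ i → u ≡ at k (i ∷ w)
    at-child {u} k w le pu with parent⇒child m pu
    ... | i , eq = i , clip-toℕ u (trans eq (cong (λ z → child z i) (toℕ-at k w (ℕ.m≤n⇒m≤1+n le))))

  open Placement

  M : ℕ
  M = N * δ ^ T

  cluster : Fin M → Fin N
  cluster j = proj₁ (remQuot {N} (δ ^ T) j)

  leafWord : Fin M → List (Fin δ)
  leafWord j = decode T (proj₂ (remQuot {N} (δ ^ T) j))

  leafWord-length : ∀ j → length (leafWord j) ≡ T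
  leafWord-length j = decode-length T _

  leafWord≤ : ∀ j → length (leafWord j) ≤ T + T
  leafWord≤ j = ℕ.≤-trans (ℕ.≤-reflexive (leafWord-length j)) (ℕ.m≤m+n T T)

  query : Placement → Fin M → Fin n
  query P j = at P (cluster j) (leafWord j)

  query-injective : ∀ P {j j'} → query P j ≡ query P j' → j ≡ j'
  query-injective P {j} {j'} eq with at-injective P (cluster j) (cluster j') (leafWord j) (leafWord j')
      (ℕ.m≤n⇒m≤1+n (leafWord≤ j)) (ℕ.m≤n⇒m≤1+n (leafWord≤ j')) eq
  ... | ek , ew = begin
      j                                             ≡⟨ sym (Fin.combine-remQuot {N} (δ ^ T) j) ⟩
      combine (cluster j) (proj₂ (rq j))            ≡⟨ cong₂ combine ek ex ⟩
      combine (cluster j') (proj₂ (rq j'))          ≡⟨ Fin.combine-remQuot {N} (δ ^ T) j' ⟩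
      j'                                            ∎
    where
    open ≡-Reasoning
    rq : Fin M → Fin N × Fin (δ ^ T)
    rq = remQuot {N} (δ ^ T)
    ex : proj₂ (rq j) ≡ proj₂ (rq j')
    ex = trans (sym (encode-decode i₀ T (proj₂ (rq j))))
        (trans (cong (encode i₀ T) ew) (encode-decode i₀ T (proj₂ (rq j'))))

  M≤n : Placement → M ≤ n
  M≤n P = Fin.injective⇒≤ (query-injective P)

  abstract

    -- The queries fill the first `M` steps; the order of all remaining nodes is immaterial and
    -- comes from an arbitrary extension.
    orderWith : (P : Placement) → Σ (Fin n ↔ Fin n) λ σ → ∀ {j} → j ∈ allFin M → Inverse.to σ
        (inject≤ j (M≤n P)) ≡ query P j
    orderWith P = extendToPermutation (λ j → inject≤ j (M≤n P)) (query P) (allFin M)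
      λ {a} {b} _ _ → mk⇔ (λ e → cong (query P) (Fin.inject≤-injective _ _ a b e))
                          (λ e → cong (λ j → inject≤ j (M≤n P)) (query-injective P e))

    order : Placement → Fin n ↔ Fin n
    order P = proj₁ (orderWith P)

    order-query : ∀ P j → Inverse.to (order P) (inject≤ j (M≤n P)) ≡ query P j
    order-query P j = proj₂ (orderWith P) (∈-allFin j)

  isQuery : ∀ P j (k : Fin n) → toℕ k ≤ toℕ (inject≤ j (M≤n P)) → ∃ λ (j' : Fin M) → k ≡ inject≤ j' (M≤n P)
  isQuery P j k k≤j = fromℕ< k<M , Fin.toℕ-injective (sym (trans (Fin.toℕ-inject≤ _ _) (Fin.toℕ-fromℕ< k<M)))
    where
    k<M : toℕ k < M
    k<M = ℕ.≤-<-trans (subst (toℕ k ≤_) (Fin.toℕ-inject≤ j _) k≤j) (Fin.toℕ<n j)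

  module _ (P P' : Placement) where

    -- The two inequalities are the invariant: the remaining steps suffice neither to climb above
    -- the cluster root nor to descend below depth `2T`, so the walk is described by words and can
    -- be repeated in `P'`.
    reach-transfer : ∀ {a k w u} → a ≤ length w → length w + a ≤ T + T → Reach t a (at P k w) u →
                     ∃ λ w' → length w' ≤ T + T × u ≡ at P k w' × Reach t a (at P' k w) (at P' k w')
    reach-transfer {w = w} _ le here = w , ℕ.≤-trans (ℕ.m≤m+n _ _) le , refl , here
    reach-transfer {suc a} {k} {i ∷ w} (s≤s a≤) le (step (inj₁ pu) r)
      with just-injective (trans (sym pu) (at-parent P k i w len))
      where
      len : length (i ∷ w) ≤ suc (T + T)
      len = ℕ.≤-trans (ℕ.m≤m+n _ (suc a)) (ℕ.m≤n⇒m≤1+n le)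
    ... | refl with reach-transfer {a} {k} {w} a≤ (ℕ.≤-trans (ℕ.+-mono-≤ (ℕ.n≤1+n _) (ℕ.n≤1+n a)) le) r
    ...   | w' , lw' , eq , r' =
            w' , lw' , eq , step (inj₁ (at-parent P' k i w (ℕ.≤-trans (ℕ.m≤m+n _ (suc a)) (ℕ.m≤n⇒m≤1+n le)))) r'
    reach-transfer {suc a} {k} {w} a≤ le (step (inj₂ pu) r) with at-child P k w
        (ℕ.≤-trans (ℕ.m≤m+n _ (suc a)) le) pu
    ... | i , refl with reach-transfer {a} {k} {i ∷ w} (ℕ.≤-trans (ℕ.n≤1+n a) (ℕ.m≤n⇒m≤1+n a≤))
        (subst (_≤ T + T) (ℕ.+-suc (length w) a) le) r
    ...   | w' , lw' , eq , r' = w' , lw' , eq , step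
        (inj₂ (at-parent P' k i w (s≤s (ℕ.≤-trans (ℕ.m≤m+n _ (suc a)) le)))) r'

    edge-transfer : ∀ {k k' w w'} → length w ≤ T + T → length w' ≤ T + T →
                    parent t (at P k w) ≡ just (at P k' w') → parent t (at P' k w) ≡ just (at P' k' w')
    edge-transfer {k} {k'} {w} {w'} le le' pu with at-child P k' w' le' pu
    ... | i , eq with at-injective P k k' w (i ∷ w') (ℕ.m≤n⇒m≤1+n le) (s≤s le') eq
    ...   | refl , refl = at-parent P' k i w' (s≤s le')

    reveal-transfer : ∀ j₀ {u} → Revealed t T (order P) (inject≤ j₀ (M≤n P)) u →
                      ∃ λ k → ∃ λ w → length w ≤ T + T × u ≡ at P k w × Revealed t T (order P')
                          (inject≤ j₀ (M≤n P')) (at P' k w)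
    reveal-transfer j₀ {u} (i , i≤ , r) with isQuery P j₀ i i≤
    ... | j , refl with reach-transfer {T} {cluster j} {leafWord j} (ℕ.≤-reflexive (sym (leafWord-length j)))
                         (ℕ.≤-reflexive (cong (_+ T) (leafWord-length j)))
                         (subst (λ z → Reach t T z u) (order-query P j) r)
    ...   | w , lw , eq , r' = cluster j , w , lw , eq , inject≤ j (M≤n P')
            , subst₂ _≤_ (trans (Fin.toℕ-inject≤ j _) (sym (Fin.toℕ-inject≤ j _)))
                         (trans (Fin.toℕ-inject≤ j₀ _) (sym (Fin.toℕ-inject≤ j₀ _))) i≤
            , subst (λ z → Reach t T z (at P' (cluster j) w)) (sym (order-query P' j)) r'

  module _ (P P' : Placement) where

    private
      index : List (Fin N × List (Fin δ))
      index = cartesianProduct (allFin N) (words≤ δ (T + T))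

      short : ∀ {p} → p ∈ index → length (proj₂ p) ≤ suc (T + T)
      short p∈ = ℕ.m≤n⇒m≤1+n (words≤-length (T + T)
          (proj₂ (∈-cartesianProduct⁻ (allFin N) (words≤ δ (T + T)) p∈)))

      matching : Σ (Fin n ↔ Fin n) λ π → ∀ {p} → p ∈ index → Inverse.to π (uncurry (at P) p) ≡ uncurry (at P') p
      matching = extendToPermutation (uncurry (at P)) (uncurry (at P')) index λ {p} {q} p∈ q∈ → mk⇔
        (λ e → let ek , ew = at-injective P (proj₁ p) (proj₁ q) (proj₂ p) (proj₂ q) (short p∈) (short q∈) e in cong₂ (at P') ek ew)
        (λ e → let ek , ew = at-injective P' (proj₁ p) (proj₁ q) (proj₂ p) (proj₂ q) (short p∈) (short q∈) e in cong₂ (at P) ek ew)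

      π = proj₁ matching
      open Inverse π

      to-at : ∀ k w → length w ≤ T + T → to (at P k w) ≡ at P' k w
      to-at k w le = proj₂ matching (∈-cartesianProduct⁺ (∈-allFin k) (∈-words≤ (T + T) w le))

    placement-view : ∀ j → OnlineView T t (order P) t (order P') (inject≤ j (M≤n P))
    placement-view j₀ = π , match , mem , edge
      where
      i  = inject≤ j₀ (M≤n P)
      match : ∀ k → k Data.Fin.≤ i → to (Inverse.to (order P) k) ≡ Inverse.to (order P') k
      match k k≤i with isQuery P j₀ k k≤i
      ... | j , refl = trans (cong to (order-query P j))
          (trans (to-at (cluster j) (leafWord j) (leafWord≤ j)) (sym (order-query P' j)))
      R  = Revealed t T (order P) i
      R' = Revealed t T (order P') i
      mem : ∀ u → R u ⇔ R' (to u)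
      mem u = mk⇔ fwd bwd
        where
        fwd : R u → R' (to u)
        fwd r with reveal-transfer P P' j₀ r
        ... | k , w , lw , refl , r' = subst R' (sym (to-at k w lw)) r'
        bwd : R' (to u) → R u
        bwd r with reveal-transfer P' P j₀ r
        ... | k , w , lw , eq , r' = subst R (to-injective π (trans (to-at k w lw) (sym eq))) r'
      edge : ∀ u w → R u → R w → (parent t u ≡ just w) ⇔ (parent t (to u) ≡ just (to w))
      edge u w ru rw with reveal-transfer P P' j₀ ru | reveal-transfer P P' j₀ rw
      ... | k , a , la , refl , _ | k' , b , lb , refl , _ = subst₂
          (λ x y → (parent t (at P k a) ≡ just (at P k' b)) ⇔ (parent t x ≡ just y))
              (sym (to-at k a la)) (sym (to-at k' b lb))
                  (mk⇔ (edge-transfer P P' la lb) (edge-transfer P' P la lb))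

    answer-independent : ∀ j → A t (order P) (inject≤ j (M≤n P)) ≡ A t (order P') (inject≤ j (M≤n P'))
    answer-independent j = loc t (order P) t (order P') (inject≤ j (M≤n P)) (placement-view j)

  output : Placement → Fin n → Fin g
  output P v = A t (order P) (Inverse.from (order P) v)

  output-cluster : ∀ P P' k w → length w ≡ T → output P (at P k w) ≡ output P' (at P' k w)
  output-cluster P P' k w len = trans (atQuery P) (trans (answer-independent P P' j) (sym (atQuery P')))
    where
    j : Fin M
    j = combine k (encode i₀ T w)
    rq : remQuot {N} (δ ^ T) j ≡ (k , encode i₀ T w)
    rq = Fin.remQuot-combine {N} {δ ^ T} k (encode i₀ T w)
    atQuery : ∀ P → output P (at P k w) ≡ A t (order P) (inject≤ j (M≤n P))
    atQuery P = cong (A t (order P)) (trans (cong (Inverse.from (order P)) (sym (trans (order-query P j)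
        (cong₂ (at P) (cong proj₁ rq) (trans (cong (decode T ∘ proj₂) rq) (decode-encode i₀ T w len))))))
      (Inverse.strictlyInverseʳ (order P) _))

++-injective : ∀ {A : Set} (a a' b b' : List A) → a ++ b ≡ a' ++ b' → length b ≡ length b' → a ≡ a' × b ≡ b'
++-injective []       []        b b' eq len = refl , eq
++-injective (x ∷ a)  (y ∷ a')  b b' eq len with ∷-injective eq
... | refl , eq′ with ++-injective a a' b b' eq′ len
...   | refl , e = refl , e
++-injective []       (y ∷ a')  b b' eq len = contradiction (trans (sym len) (cong length eq))
  (ℕ.<⇒≢ (s≤s (ℕ.≤-trans (ℕ.m≤n+m _ (length a')) (ℕ.≤-reflexive (sym (length-++ a'))))))
++-injective (x ∷ a)  []        b b' eq len = contradiction (trans len (cong length (sym eq)))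
  (ℕ.<⇒≢ (s≤s (ℕ.≤-trans (ℕ.m≤n+m _ (length a)) (ℕ.≤-reflexive (sym (length-++ a))))))

-- Disjoint regions in the heap

module _ (δ : ℕ) {{_ : NonZero δ}} where

  open Heap δ
  open Descend δ

  v≤descend : ∀ v w → v ≤ descend v w
  v≤descend v []      = ℕ.≤-refl
  v≤descend v (i ∷ w) = ℕ.≤-trans (v≤descend v w) (ℕ.<⇒≤ (a<child (descend v w) i))

  descend-upper : ∀ v w → suc (descend v w) ≤ suc δ ^ length w * suc v
  descend-upper v []      = ℕ.≤-reflexive (sym (ℕ.*-identityˡ (suc v)))
  descend-upper v (i ∷ w) = begin
    suc (suc (toℕ i + x * δ))        ≤⟨ s≤s (ℕ.+-monoˡ-≤ (x * δ) (Fin.toℕ<n i)) ⟩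
    suc (δ + x * δ)                  ≤⟨ s≤s (ℕ.m≤n+m (δ + x * δ) x) ⟩
    suc x + suc x * δ                ≡⟨ sym (ℕ.*-suc (suc x) δ) ⟩
    suc x * suc δ                    ≤⟨ ℕ.*-monoˡ-≤ (suc δ) (descend-upper v w) ⟩
    suc δ ^ length w * suc v * suc δ ≡⟨ ℕ.*-comm (suc δ ^ length w * suc v) (suc δ) ⟩
    suc δ * (suc δ ^ length w * suc v) ≡⟨ sym (ℕ.*-assoc (suc δ) (suc δ ^ length w) (suc v)) ⟩
    suc δ * suc δ ^ length w * suc v ∎
    where
    open ℕ.≤-Reasoning
    x = descend v w

  descend-unary : δ ≡ 1 → ∀ v w → descend v w ≡ v + length w
  descend-unary eq v []      = sym (ℕ.+-identityʳ v)
  descend-unary eq v (i ∷ w) = begin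
    suc (toℕ i + descend v w * δ)  ≡⟨ cong₂ (λ a b → suc (a + b)) i≡0
        (trans (cong (descend v w *_) eq) (ℕ.*-identityʳ _)) ⟩
    suc (descend v w)              ≡⟨ cong suc (descend-unary eq v w) ⟩
    suc (v + length w)             ≡⟨ sym (ℕ.+-suc v (length w)) ⟩
    v + suc (length w)             ∎
    where
    open ≡-Reasoning
    i≡0 : toℕ i ≡ 0
    i≡0 = ℕ.n<1⇒n≡0 (subst (toℕ i <_) eq (Fin.toℕ<n i))

  descend-branching : 2 ≤ δ → ∀ v i w → v + v < descend v (i ∷ w)
  descend-branching 2≤δ v i w = s≤s (begin
    v + v              ≡⟨ cong (v +_) (sym (ℕ.+-identityʳ v)) ⟩
    2 * v              ≤⟨ ℕ.*-mono-≤ 2≤δ (v≤descend v w) ⟩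
    δ * descend v w    ≡⟨ ℕ.*-comm δ (descend v w) ⟩
    descend v w * δ    ≤⟨ ℕ.m≤n+m _ (toℕ i) ⟩
    toℕ i + descend v w * δ ∎)
    where open ℕ.≤-Reasoning

  one-or-more : δ ≡ 1 ⊎ 2 ≤ δ
  one-or-more with δ ℕ.≟ 1
  ... | yes e = inj₁ e
  ... | no ne = inj₂ (ℕ.≤∧≢⇒< (>-nonZero⁻¹ δ) (ne ∘ sym))

  module Regions (N h : ℕ) where

    -- All roots lie in `[R, 2R)` for `R = N * suc h`. If `δ ≥ 2`, proper descendants more than
    -- double the number, so no root lies below another. If `δ = 1`, the heap is a path and the
    -- spacing `suc h` keeps regions of depth `h` apart.
    regionRoot : Fin N → ℕ
    regionRoot k = (N + toℕ k) * suc h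

    regionRoot-not-below : ∀ k k' i w → length (i ∷ w) ≤ h → regionRoot k ≢ descend (regionRoot k') (i ∷ w)
    regionRoot-not-below k k' i w le eq with one-or-more
    ... | inj₂ 2≤δ = ℕ.<-irrefl eq (begin-strict
        (N + toℕ k) * suc h              <⟨ ℕ.*-monoˡ-< (suc h) (ℕ.+-monoʳ-< N (Fin.toℕ<n k)) ⟩
        (N + N) * suc h                  ≤⟨ ℕ.*-monoˡ-≤ (suc h)
            (ℕ.+-mono-≤ (ℕ.m≤m+n N (toℕ k')) (ℕ.m≤m+n N (toℕ k'))) ⟩
        ((N + toℕ k') + (N + toℕ k')) * suc h ≡⟨ ℕ.*-distribʳ-+ (suc h) (N + toℕ k') (N + toℕ k') ⟩
        regionRoot k' + regionRoot k'    <⟨ descend-branching 2≤δ (regionRoot k') i w ⟩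
        descend (regionRoot k') (i ∷ w)  ∎)
      where open ℕ.≤-Reasoning
    ... | inj₁ δ≡1 = ℕ.<-irrefl (sym eq′) (begin-strict
        regionRoot k' + length (i ∷ w)   <⟨ ℕ.+-monoʳ-< (regionRoot k') (s≤s le) ⟩
        regionRoot k' + suc h            ≡⟨ ℕ.+-comm (regionRoot k') (suc h) ⟩
        suc (N + toℕ k') * suc h         ≤⟨ ℕ.*-monoˡ-≤ (suc h) above ⟩
        regionRoot k                     ∎)
      where
      open ℕ.≤-Reasoning
      eq′ : regionRoot k ≡ regionRoot k' + length (i ∷ w)
      eq′ = trans eq (descend-unary δ≡1 (regionRoot k') (i ∷ w))
      above : N + toℕ k' < N + toℕ k
      above = ℕ.*-cancelʳ-< (suc h) _ _ (subst (regionRoot k' <_) (sym eq′) (ℕ.m<m+n (regionRoot k') (s≤s z≤n)))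

    -- Equal last steps are peeled off both words; if only one word runs out, a region root would
    -- lie below a region root.
    region-separated : ∀ k k' w w' → length w ≤ h → length w' ≤ h →
                       descend (regionRoot k) w ≡ descend (regionRoot k') w' → k ≡ k' × w ≡ w'
    region-separated k k' [] [] _ _ eq =
      Fin.toℕ-injective (ℕ.+-cancelˡ-≡ N _ _ (ℕ.*-cancelʳ-≡ _ _ (suc h) eq)) , refl
    region-separated k k' [] (i ∷ w') _ le eq = contradiction eq (regionRoot-not-below k k' i w' le)
    region-separated k k' (i ∷ w) [] le _ eq = contradiction (sym eq) (regionRoot-not-below k' k i w le)
    region-separated k k' (i ∷ w) (j ∷ w') le le' eq with child-injective {descend
        (regionRoot k) w} {descend (regionRoot k') w'} {i} {j} eq
    ... | eq′ , refl with region-separated k k' w w' (ℕ.<⇒≤ le) (ℕ.<⇒≤ le') eq′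
    ...   | refl , refl = refl , refl

    region-bound : ∀ k w → length w ≤ h → suc (descend (regionRoot k) w) ≤ suc δ ^ h * suc ((N + N) * suc h)
    region-bound k w le = ℕ.≤-trans (descend-upper (regionRoot k) w)
      (ℕ.*-mono-≤ (ℕ.^-monoʳ-≤ (suc δ) le) (s≤s (ℕ.*-monoˡ-≤ (suc h) (ℕ.+-monoʳ-≤ N (ℕ.<⇒≤ (Fin.toℕ<n k))))))

-- From a recurring layer to a certificate

-- Otherwise each of the g + 1 layers would have a private label.
recurringLayer : ∀ {g Q R} (β : Fin (suc g) → Fin Q → Fin R → Fin g) →
  ∃ λ i* → ∀ x z → ∃ λ i → ∃ λ x' → ∃ λ z' → i ≢ i* × β i x' z' ≡ β i* x z
recurringLayer {g} {Q} {R} β with Fin.any? good?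
  where
  good? : (i* : Fin (suc g)) → Dec (∀ x z → ∃ λ i → ∃ λ x' → ∃ λ z' → i ≢ i* × β i x' z' ≡ β i* x z)
  good? i* = Fin.all? λ x → Fin.all? λ z → Fin.any? λ i → Fin.any? λ x' → Fin.any? λ z' →
    ¬? (i Fin.≟ i*) ×-dec (β i x' z' Fin.≟ β i* x z)
... | yes found = found
... | no none = contradiction (Fin.pigeonhole ℕ.≤-refl (λ i → proj₁ (private-label i)))
    λ { (i , j , i<j , eq) → let _ , x , z , e , _ = private-label i ; _ , x' , z' , e' , un = private-label j in
        un i (x , z , Fin.<⇒≢ i<j , trans e (trans eq (sym e'))) }
  where
  OccursAt : Fin (suc g) → Fin Q → Fin R → Fin (suc g) → Set
  OccursAt i* x z i = ∃ λ x' → ∃ λ z' → i ≢ i* × β i x' z' ≡ β i* x z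
  occurs? : ∀ i* x z → Dec (∃ λ i → OccursAt i* x z i)
  occurs? i* x z = Fin.any? λ i → Fin.any? λ x' → Fin.any? λ z' → ¬? (i Fin.≟ i*) ×-dec
      (β i x' z' Fin.≟ β i* x z)
  private-label : ∀ i → ∃ λ γ → ∃ λ x → ∃ λ z → β i x z ≡ γ × (∀ j → ¬ OccursAt i x z j)
  private-label i with Fin.¬∀⟶∃¬ Q _ (λ x → Fin.all? λ z → occurs? i x z) (λ all → none (i , all))
  ... | x , ¬x with Fin.¬∀⟶∃¬ R _ (λ z → occurs? i x z) ¬x
  ...   | z , ¬z = β i x z , x , z , refl , λ j o → ¬z (j , o)

module Layers (Π : LCL) {{_ : NonZero (LCL.δ Π)}} (T m : ℕ)
  (A : OnlineAlg Π (Heap.size (LCL.δ Π) m)) (loc : HasLocalityOnline Π (Heap.size (LCL.δ Π) m) T A)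
  (feas : ∀ t σ → Feasible Π t (λ v → A t σ (Inverse.from σ v)))
  (Y h : ℕ) (Y-large : suc (suc (T + suc (T + T))) ≤ Y) (h-large : suc (T + T) + (Y + T) ≤ h) where

  open LCL Π
  open Heap δ
  open Descend δ

  -- A layer has `δ ^ Y` clusters, which is enough for the bottom of every tree, as that takes
  -- `δ ^ ylen` of them with `ylen ≤ Y`.
  d Q : ℕ
  d = suc (T + T)
  Q = δ ^ Y

  N : ℕ
  N = suc g * Q

  open Clusters Π T m A loc N
  open Regions δ N h
  open Placement

  module _ (big : suc δ ^ h * suc ((N + N) * suc h) ≤ size m) where

    region< : ∀ k w → length w ≤ h → descend (regionRoot k) w < n
    region< k w le = ℕ.≤-trans (region-bound k w le) big

    base : Placement
    base = record
      { pos       = regionRoot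
      ; bounded   = λ k w le → region< k w (ℕ.≤-trans le short)
      ; separated = λ k k' w w' le le' → region-separated k k' w w' (ℕ.≤-trans le short) (ℕ.≤-trans le' short)
      }
      where
      short : suc (T + T) ≤ h
      short = ℕ.≤-trans (ℕ.m≤m+n _ (Y + T)) h-large

    β : Fin (suc g) → Fin Q → Fin (δ ^ T) → Fin g
    β i x z = output base (at base (combine i x) (decode T z))

    module WithLayer (i* : Fin (suc g))
      (elsewhere : ∀ x z → ∃ λ i → ∃ λ x' → ∃ λ z' → i ≢ i* × β i x' z' ≡ β i* x z) where

      -- The tree of depth D + e hangs below a leaf of cluster k*, and its own leaf layer is
      -- made of clusters of layer i*, whose roots lie at depth ylen = D + e − T in it.
      module Tree (e : Fin (suc d)) (k* : Fin N) (w* : List (Fin δ)) (w*-length : length w* ≡ T)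
                  (k*-layer : ∀ x → k* ≢ combine i* x) (ylen : ℕ) (ylen≡ : ylen ≡ suc (suc (T + toℕ e))) where

        ylen≤Y : ylen ≤ Y
        ylen≤Y = ℕ.≤-trans (subst (_≤ suc (suc (T + d))) (sym ylen≡)
            (s≤s (s≤s (ℕ.+-monoʳ-≤ T (ℕ.≤-pred (Fin.toℕ<n e)))))) Y-large

        T+ylen : T + ylen ≡ suc d + toℕ e
        T+ylen = trans (cong (T +_) ylen≡) (trans (ℕ.+-suc T (suc (T + toℕ e)))
            (cong suc (trans (ℕ.+-suc T (T + toℕ e)) (cong suc (sym (ℕ.+-assoc T T (toℕ e)))))))

        slot : Fin (δ ^ ylen) → Fin Q
        slot y = inject≤ y (ℕ.^-monoʳ-≤ δ ylen≤Y)

        -- A cluster is described by the region it lies in and the word leading to it. Collisions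
        -- between clusters then reduce, by `region-separated`, to equations between words.
        data Located (k : Fin N) : Fin N → List (Fin δ) → Set where
          moved : ∀ y → k ≡ combine i* (slot y) → Located k k* (decode ylen y ++ w*)
          fixed : Located k k []

        located : ∀ k → ∃ λ k° → ∃ λ u → Located k k° u
        located k with Fin.any? (λ y → k Fin.≟ combine i* (slot y))
        ... | yes (y , eq) = _ , _ , moved y eq
        ... | no _         = _ , _ , fixed

        position : Fin N → ℕ
        position k = let k° , u , _ = located k in descend (regionRoot k°) u

        position-moved : ∀ y → position (combine i* (slot y)) ≡ descend (regionRoot k*) (decode ylen y ++ w*)
        position-moved y with Fin.any? (λ y' → combine i* (slot y) Fin.≟ combine i* (slot y'))
        ... | no none = contradiction (y , refl) none
        ... | yes (y' , eq) = cong (λ z → descend (regionRoot k*) (decode ylen z ++ w*))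
                (sym (Fin.inject≤-injective _ _ y y' (Fin.combine-injectiveʳ i* (slot y) i* (slot y') eq)))

        position-k* : position k* ≡ regionRoot k*
        position-k* with Fin.any? (λ y → k* Fin.≟ combine i* (slot y))
        ... | yes (y , eq) = contradiction eq (k*-layer (slot y))
        ... | no _         = refl

        moved-length : ∀ y → length (decode ylen y ++ w*) ≡ ylen + T
        moved-length y = trans (length-++ (decode ylen y)) (cong₂ _+_ (decode-length ylen y) w*-length)

        located-length : ∀ {k k° u} → Located k k° u → length u ≤ Y + T
        located-length (moved y _) = ℕ.≤-trans (ℕ.≤-reflexive (moved-length y)) (ℕ.+-monoˡ-≤ T ylen≤Y)
        located-length fixed       = z≤n

        total-length : ∀ {k k° u} → Located k k° u → ∀ w → length w ≤ suc (T + T) → length (w ++ u) ≤ h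
        total-length l w le = ℕ.≤-trans (ℕ.≤-trans (ℕ.≤-reflexive (length-++ w))
            (ℕ.+-mono-≤ le (located-length l))) h-large

        -- The origin of `D = 2T + 2`: a moved cluster starts at depth `ylen + T = 2T + 2 + e` of
        -- the region of `k*`, just beyond the depth `2T + 1` that cluster `k*` claims for itself.
        moved≢short : ∀ y w w' → length w' ≤ suc (T + T) → w ++ (decode ylen y ++ w*) ≢ w' ++ []
        moved≢short y w w' le eq = ℕ.<-irrefl (sym (cong length eq)) (begin-strict
          length (w' ++ [])                      ≡⟨ trans (length-++ w') (ℕ.+-identityʳ _) ⟩
          length w'                              ≤⟨ le ⟩
          suc (T + T)                            <⟨ ℕ.≤-refl ⟩
          suc (suc (T + T))                      ≤⟨ s≤s (s≤s (ℕ.+-monoˡ-≤ T (ℕ.m≤m+n T (toℕ e)))) ⟩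
          suc (suc (T + toℕ e + T))              ≡⟨ cong (_+ T) (sym ylen≡) ⟩
          ylen + T                               ≡⟨ sym (moved-length y) ⟩
          length (decode ylen y ++ w*)           ≤⟨ ℕ.m≤n+m _ (length w) ⟩
          length w + length (decode ylen y ++ w*) ≡⟨ sym (length-++ w) ⟩
          length (w ++ (decode ylen y ++ w*))    ∎)
          where open ℕ.≤-Reasoning

        located-injective : ∀ {k k' k° u u'} → Located k k° u → Located k' k° u' → ∀ w w' →
                            length w ≤ suc (T + T) → length w' ≤ suc (T + T) → w ++ u ≡ w' ++ u' → k
                                ≡ k' × w ≡ w'
        located-injective fixed fixed w w' _ _ eq = refl , proj₁ (++-injective w w' [] [] eq refl)
        located-injective (moved y _) fixed w w' _ le' eq = contradiction eq (moved≢short y w w' le')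
        located-injective fixed (moved y _) w w' le _ eq = contradiction (sym eq) (moved≢short y w' w le)
        located-injective (moved y refl) (moved y' refl) w w' _ _ eq
          with ++-injective w w' _ _ eq (trans (moved-length y) (sym (moved-length y')))
        ... | refl , eq′ = cong (λ z → combine i* (slot z)) y≡y' , refl
          where
          y≡y' : y ≡ y'
          y≡y' = trans (sym (encode-decode i₀ ylen y)) (trans (cong (encode i₀ ylen)
            (proj₁ (++-injective (decode ylen y) (decode ylen y') w* w* eq′ refl))) (encode-decode i₀ ylen y'))

        placement : Placement
        placement = record
          { pos       = position
          ; bounded   = λ k w le → let k° , u , l = located k in
                          subst (_< n) (descend-++ (regionRoot k°) w u)
                              (region< k° (w ++ u) (total-length l w le))
          ; separated = sep
          }
          where
          sep : ∀ k k' w w' → length w ≤ suc (T + T) → length w' ≤ suc (T + T) →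
                descend (position k) w ≡ descend (position k') w' → k ≡ k' × w ≡ w'
          sep k k' w w' le le' eq with located k | located k'
          ... | k° , u , l | k'° , u' , l'
            with region-separated k° k'° (w ++ u) (w' ++ u') (total-length l w le) (total-length l' w' le')
                   (trans (descend-++ (regionRoot k°) w u) (trans eq (sym (descend-++ (regionRoot k'°) w' u'))))
          ...   | refl , eq′ = located-injective l l' w w' le le' eq′

        top : ℕ
        top = descend (regionRoot k*) w*

        labelAt : List (Fin δ) → Fin g
        labelAt u = output placement (clip (descend top u))

        label-top : labelAt [] ≡ output base (at base k* w*)
        label-top = trans (cong (λ z → output placement (clip (descend z w*))) (sym position-k*))
                          (output-cluster placement base k* w* w*-length)

        -- Leaves of the tree are queried nodes of moved clusters, whose answers are those of the
        -- base placement. The right-hand side mentions neither `k*` nor `w*`; this is what makes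
        -- trees stackable.
        label-bottom : ∀ z y → length z ≡ T → length y ≡ ylen →
                       labelAt (z ++ y) ≡ β i* (slot (encode i₀ ylen y)) (encode i₀ T z)
        label-bottom z y lz ly = begin
          output placement (clip (descend top (z ++ y)))   ≡⟨ cong (output placement ∘ clip) node ⟩
          output placement (at placement k z)              ≡⟨ output-cluster placement base k z lz ⟩
          output base (at base k z)                        ≡⟨ cong (output base ∘ at base k)
              (sym (decode-encode i₀ T z lz)) ⟩
          β i* (slot (encode i₀ ylen y)) (encode i₀ T z)   ∎
          where
          open ≡-Reasoning
          k : Fin N
          k = combine i* (slot (encode i₀ ylen y))
          node : descend top (z ++ y) ≡ descend (position k) z
          node = begin
            descend top (z ++ y)                                ≡⟨ descend-++ top z y ⟩
            descend (descend top y) z                           ≡⟨ cong (λ a → descend a z)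
                (sym (descend-++ (regionRoot k*) y w*)) ⟩
            descend (descend (regionRoot k*) (y ++ w*)) z       ≡⟨ cong
                (λ a → descend (descend (regionRoot k*) (a ++ w*)) z) (sym (decode-encode i₀ ylen y ly)) ⟩
            descend (descend (regionRoot k*) (decode ylen (encode i₀ ylen y) ++ w*)) z ≡⟨ cong
                (λ a → descend a z) (sym (position-moved (encode i₀ ylen y))) ⟩
            descend (position k) z                              ∎

        inTree : ∀ u → length u ≤ suc d + toℕ e → descend top u < n
        inTree u le = subst (_< n) (descend-++ (regionRoot k*) u w*) (region< k* (u ++ w*) (begin
          length (u ++ w*)            ≡⟨ length-++ u ⟩
          length u + length w*        ≤⟨ ℕ.+-mono-≤ le (ℕ.≤-reflexive w*-length) ⟩
          suc d + toℕ e + T           ≡⟨ cong (_+ T) (sym T+ylen) ⟩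
          T + ylen + T                ≡⟨ ℕ.+-assoc T ylen T ⟩
          T + (ylen + T)              ≤⟨ ℕ.+-mono-≤ (ℕ.m≤n⇒m≤1+n (ℕ.m≤m+n T T)) (ℕ.+-monoˡ-≤ T ylen≤Y) ⟩
          suc (T + T) + (Y + T)       ≤⟨ h-large ⟩
          h                           ∎))
          where open ℕ.≤-Reasoning

        -- No control over the labels inside the tree is required: feasibility of the output on this
        -- placement is all that is used, with the enumeration of children rewritten as a
        -- permutation of heap indices.
        label-allowed : ∀ u → length u < suc d + toℕ e → AllowedUpToOrder Π (labelAt u) (λ i → labelAt (i ∷ u))
        label-allowed u lt = fromFeasible (feas t (order placement) v
            (heapChildren m v (subst (_< m) (sym toℕv)
                (child<⇒internal m (descend top u) i₀ (inTree (i₀ ∷ u) lt)))))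
          where
          v : Fin n
          v = clip (descend top u)
          toℕv : toℕ v ≡ descend top u
          toℕv = toℕ-clip (inTree u (ℕ.<⇒≤ lt))
          fromFeasible : Σ (ChildEnum (parent t) δ v)
              (λ ce → (output placement v , tabulate (λ i → output placement (proj₁ ce i))) ∈ C) →
                         AllowedUpToOrder Π (labelAt u) (λ i → labelAt (i ∷ u))
          fromFeasible ((f , inj , par , sur) , mem) = ρ , ρ-injective , ρ-surjective
              , subst (_∈ C) (cong (labelAt u ,_) (tabulate-cong (λ i → cong (output placement) (f≡ i)))) mem
            where
            ρ : Fin δ → Fin δ
            ρ i = proj₁ (parent⇒child m (par i))
            toℕf : ∀ i → toℕ (f i) ≡ descend top (ρ i ∷ u)
            toℕf i = trans (proj₂ (parent⇒child m (par i))) (cong (λ z → child z (ρ i)) toℕv)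
            f≡ : ∀ i → f i ≡ clip (descend top (ρ i ∷ u))
            f≡ i = clip-toℕ (f i) (toℕf i)
            ρ-injective : Injective ρ
            ρ-injective {i} {j} eq = inj (trans (f≡ i)
                (trans (cong (λ z → clip (descend top (z ∷ u))) eq) (sym (f≡ j))))
            ρ-surjective : ∀ i → ∃ λ j → ρ j ≡ i
            ρ-surjective i with sur (clip (descend top (i ∷ u)))
                  (child⇒parent m i (trans (toℕ-clip (inTree (i ∷ u) lt)) (cong (λ z → child z i) (sym toℕv))))
            ... | j , eq = j , proj₂ (child-injective {descend top u} {descend top u}
                (trans (sym (toℕf j)) (trans (cong toℕ eq) (toℕ-clip (inTree (i ∷ u) lt)))))

      module Below (e : Fin (suc d)) (x : Fin Q) (z : Fin (δ ^ T)) where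

        private
          i′ = proj₁ (elsewhere x z)
          x′ = proj₁ (proj₂ (elsewhere x z))
          z′ = proj₁ (proj₂ (proj₂ (elsewhere x z)))

        open Tree e (combine i′ x′) (decode T z′) (decode-length T z′)
          (λ x″ eq → proj₁ (proj₂ (proj₂ (proj₂ (elsewhere x z)))) (Fin.combine-injectiveˡ i′ x′ i* x″ eq))
          (suc (suc (T + toℕ e))) refl public

        label-root : labelAt [] ≡ β i* x z
        label-root = trans label-top (proj₂ (proj₂ (proj₂ (proj₂ (elsewhere x z)))))

      certificate : Certificate Π
      certificate = record
        { d        = d
        ; I        = Fin Q × Fin (δ ^ T)
        ; name     = λ { (x , z) → β i* x z }
        ; leaf     = leaf
        ; lab      = λ { e (x , z) → Below.labelAt e x z }
        ; lab-root = λ { e (x , z) → Below.label-root e x z }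
        ; lab-leaf = λ { e (x , z) u len → lab-leaf e x z u len }
        ; lab-conf = λ { e (x , z) → Below.label-allowed e x z }
        }
        where
        ylen : Fin (suc d) → ℕ
        ylen e = suc (suc (T + toℕ e))
        -- Words are deepest first: the first `T` letters are the path inside a bottom cluster, the
        -- rest addresses that cluster.
        leaf : Fin (suc d) → List (Fin δ) → Fin Q × Fin (δ ^ T)
        leaf e u = inject≤ (encode i₀ (ylen e) (drop T u))
            (ℕ.^-monoʳ-≤ δ (ℕ.≤-trans (s≤s (s≤s (ℕ.+-monoʳ-≤ T (ℕ.≤-pred (Fin.toℕ<n e))))) Y-large))
                 , encode i₀ T (take T u)
        lab-leaf : ∀ e x z u → length u ≡ suc d + toℕ e → Below.labelAt e x z u ≡ β i* (proj₁ (leaf e u))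
            (proj₂ (leaf e u))
        lab-leaf e x z u len = trans (cong labelAt (sym (take++drop≡id T u)))
            (label-bottom (take T u) (drop T u) lz ly)
          where
          open Below e x z using (labelAt; label-bottom; T+ylen)
          lu : length u ≡ T + ylen e
          lu = trans len (sym T+ylen)
          lz : length (take T u) ≡ T
          lz = trans (length-take T u) (trans (cong (T ⊓_) lu) (ℕ.m≤n⇒m⊓n≡m (ℕ.m≤m+n T _)))
          ly : length (drop T u) ≡ ylen e
          ly = trans (length-drop T u) (trans (cong (_∸ T) lu) (ℕ.m+n∸m≡n T _))

    certificate : Certificate Π
    certificate = WithLayer.certificate (proj₁ (recurringLayer β)) (proj₂ (recurringLayer β))

-- Estimates and the two bounds

1≤2^n : ∀ n → 1 ≤ 2 ^ n
1≤2^n n = ℕ.m^n>0 2 n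

n<2^n : ∀ n → suc n ≤ 2 ^ n
n<2^n zero    = ℕ.≤-refl
n<2^n (suc n) = begin
  1 + suc n        ≤⟨ ℕ.+-mono-≤ (1≤2^n n) (n<2^n n) ⟩
  2 ^ n + 2 ^ n    ≡⟨ cong (2 ^ n +_) (sym (ℕ.+-identityʳ (2 ^ n))) ⟩
  2 ^ suc n        ∎
  where open ℕ.≤-Reasoning

*-≤-2^ : ∀ {a b} p q → a ≤ 2 ^ p → b ≤ 2 ^ q → a * b ≤ 2 ^ (p + q)
*-≤-2^ {a} {b} p q a≤ b≤ = subst (a * b ≤_) (sym (ℕ.^-distribˡ-+-* 2 p q)) (ℕ.*-mono-≤ a≤ b≤)

^-≤-2^ : ∀ {a} p k → a ≤ 2 ^ p → a ^ k ≤ 2 ^ (p * k)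
^-≤-2^ {a} p k a≤ = subst (a ^ k ≤_) (ℕ.^-*-assoc 2 p k) (ℕ.^-monoˡ-≤ k a≤)

suc-≤-* : ∀ {a} s → 1 ≤ a → s + a ≤ a * suc s
suc-≤-* {a} s 1≤a = begin
  s + a          ≡⟨ ℕ.+-comm s a ⟩
  a + s          ≤⟨ ℕ.+-monoʳ-≤ a (ℕ.m≤n*m s a {{>-nonZero 1≤a}}) ⟩
  a + a * s      ≡⟨ sym (ℕ.*-suc a s) ⟩
  a * suc s      ∎
  where open ℕ.≤-Reasoning

log-reflects-≥ : ∀ n x → x < ⌊log₂ n ⌋ → 2 ^ x ≤ n
log-reflects-≥ n x x<log = ℕ.≮⇒≥ λ n<2^x →
  ℕ.<⇒≱ x<log (subst (⌊log₂ n ⌋ ≤_) (⌊log₂[2^n]⌋≡n x) (⌊log₂⌋-mono-≤ (ℕ.<⇒≤ n<2^x)))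

module _ (Π : LCL) where

  open LCL Π

  private
    instance
      δ≢0 : NonZero δ
      δ≢0 = >-nonZero δ≥1

  -- With `Y = 3T + 3` and `h = 6T + 4` the adversary needs at most
  -- `2 ^ (δ * h + 2 + g + δ * Y + h)` nodes; these are the two coefficients of that exponent in
  -- `T`.
  slope offset : ℕ
  slope  = 9 * δ + 6
  offset = 7 * δ + g + 6

  module _ (T : ℕ) where

    private
      Y h N : ℕ
      Y = suc (suc (T + suc (T + T)))
      h = suc (T + T) + (Y + T)
      N = suc g * δ ^ Y

    adversary-size : suc δ ^ h * suc ((N + N) * suc h) ≤ 2 ^ (slope * T + offset)
    adversary-size = subst (λ z → suc δ ^ h * suc ((N + N) * suc h) ≤ 2 ^ z) exponent
        (*-≤-2^ (δ * h) (2 + (g + δ * Y) + h) (^-≤-2^ δ h (n<2^n δ)) (begin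
      suc ((N + N) * suc h)              ≤⟨ suc-≤ ((N + N) * suc h) (1 + (g + δ * Y) + h)
          (*-≤-2^ (1 + (g + δ * Y)) h double (n<2^n h)) ⟩
      2 ^ (2 + (g + δ * Y) + h)          ∎))
      where
      open ℕ.≤-Reasoning
      suc-≤ : ∀ a p → a ≤ 2 ^ p → suc a ≤ 2 ^ suc p
      suc-≤ a p a≤ = ℕ.≤-trans (ℕ.+-mono-≤ (1≤2^n p) a≤)
          (ℕ.≤-reflexive (cong (2 ^ p +_) (sym (ℕ.+-identityʳ (2 ^ p)))))
      N≤ : N ≤ 2 ^ (g + δ * Y)
      N≤ = *-≤-2^ g (δ * Y) (n<2^n g) (^-≤-2^ δ Y (ℕ.<⇒≤ (n<2^n δ)))
      double : N + N ≤ 2 ^ (1 + (g + δ * Y))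
      double = ℕ.≤-trans (ℕ.+-mono-≤ N≤ N≤) (ℕ.≤-reflexive (cong (2 ^ (g + δ * Y) +_) (sym (ℕ.+-identityʳ _))))
      exponent : δ * h + (2 + (g + δ * Y) + h) ≡ slope * T + offset
      exponent = solve 3 (λ t a b →
          let y = con 2 :+ (t :+ (con 1 :+ (t :+ t)))
              r = con 1 :+ (t :+ t) :+ (y :+ t)
          in a :* r :+ (con 2 :+ (b :+ a :* y) :+ r) := (con 9 :* a :+ con 6) :* t :+
              (con 7 :* a :+ b :+ con 6)) refl T δ g
        where open +-*-Solver

    online⇒certificate : ∀ n → RTree δ n → 2 ^ (slope * T + offset) ≤ n → SolvesOnline Π n T → Certificate Π
    online⇒certificate n tree large solves with size≡1+multiple tree
    ... | m , refl = Layers.certificate Π T m (proj₁ solves) (proj₁ (proj₂ solves)) (proj₂ (proj₂ solves)) Y h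
                       ℕ.≤-refl ℕ.≤-refl (ℕ.≤-trans adversary-size large)

  -- For `T ≥ 1` the offset is absorbed into `offset * T`. For `T = 0` the logarithm gives nothing
  -- useful, and the threshold `2 ^ offset ≤ n` takes over.
  large-enough : ∀ n T → 2 ^ offset ≤ n → (slope + offset) * T < ⌊log₂ n ⌋ → 2 ^ (slope * T + offset) ≤ n
  large-enough n zero    n₀≤n _   = subst (λ z → 2 ^ (z + offset) ≤ n) (sym (ℕ.*-zeroʳ slope)) n₀≤n
  large-enough n (suc T) _    log = log-reflects-≥ n _ (ℕ.≤-<-trans (begin
    slope * suc T + offset           ≤⟨ ℕ.+-monoʳ-≤ (slope * suc T) (ℕ.m≤m*n offset (suc T)) ⟩
    slope * suc T + offset * suc T   ≡⟨ sym (ℕ.*-distribʳ-+ (suc T) slope offset) ⟩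
    (slope + offset) * suc T         ∎) log)
    where open ℕ.≤-Reasoning

-- With `u = 2D + E`, the linear side at `2u` is at most `u * u`, while `suc u ≤ 2 ^ u` squares to a
-- bound by `2 ^ (u + u)`.
exponential-beats-linear : ∀ D E → 1 ≤ D → ∃ λ z → z * D + E < 2 ^ z
exponential-beats-linear D E 1≤D = u + u , (begin-strict
  (u + u) * D + E          ≤⟨ ℕ.+-monoʳ-≤ ((u + u) * D) (ℕ.m≤n*m E u {{>-nonZero 1≤u}}) ⟩
  (u + u) * D + u * E      ≡⟨ solve 3 (λ u d e → (u :+ u) :* d :+ u :* e := u :* (d :+ d :+ e)) refl u D E ⟩
  u * u                    <⟨ ℕ.*-mono-< (ℕ.n<1+n u) (ℕ.n<1+n u) ⟩
  suc u * suc u            ≤⟨ *-≤-2^ u u (n<2^n u) (n<2^n u) ⟩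
  2 ^ (u + u)              ∎)
  where
  open ℕ.≤-Reasoning
  open +-*-Solver
  u = D + D + E
  1≤u : 1 ≤ u
  1≤u = ℕ.≤-trans 1≤D (ℕ.≤-trans (ℕ.m≤m+n D D) (ℕ.m≤m+n (D + D) E))

-- The effect of one coin tossing on exponents: a bit length affine in `2 ^ y` becomes a number of
-- colours with exponent `y` plus a constant.
suc-affine-≤-2^ : ∀ y A s r → suc ((2 ^ y + A) * s + r) ≤ 2 ^ (y + (suc A * s + r))
suc-affine-≤-2^ y A s r = ℕ.≤-trans (begin
  suc ((x + A) * s + r)               ≤⟨ s≤s (ℕ.+-mono-≤
      (ℕ.*-monoˡ-≤ s (ℕ.≤-trans (ℕ.≤-reflexive (ℕ.+-comm x A)) (suc-≤-* A 1≤x)))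
      (ℕ.m≤n*m r x {{>-nonZero 1≤x}})) ⟩
  suc (x * suc A * s + x * r)         ≤⟨ ℕ.+-monoˡ-≤ _ 1≤x ⟩
  x + (x * suc A * s + x * r)         ≡⟨ solve 4
      (λ x a s r → x :+ (x :* (con 1 :+ a) :* s :+ x :* r) := x :*
      (con 1 :+ ((con 1 :+ a) :* s :+ r))) refl x A s r ⟩
  x * suc (suc A * s + r)             ∎) (*-≤-2^ y (suc A * s + r) ℕ.≤-refl (n<2^n (suc A * s + r)))
  where
  open ℕ.≤-Reasoning
  open +-*-Solver
  x = 2 ^ y
  1≤x : 1 ≤ x
  1≤x = 1≤2^n y

module _ (c : ℕ) (Π : LCL) (cert : Certificate Π) where

  open LCL Π
  open Certificate cert using (d)

  private
    instance
      δ≢0 : NonZero δ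
      δ≢0 = >-nonZero δ≥1

  -- With x = 2^(2^z) ≈ log n the first coin tossing leaves 2^(O(2^z)) colours and the second
  -- 2^(O(z)) ones, which for large z is smaller than any constant fraction of x.
  certificate⇒fastLocal : ∀ k n₀ → ∃ λ n → n₀ ≤ n × RTree δ n × ∃ λ T → SolvesLOCAL c Π n T × k * T < ⌊log₂ n ⌋
  certificate⇒fastLocal k n₀ = n , n₀≤n , Heap.heap δ m , radius , solves , kT<log
    where
    open ℕ.≤-Reasoning
    D = suc d
    -- `a₀` is the part of `radius` free of `q`, and `A₀` and `A₁` absorb the constants of the two
    -- tosses. `E` gathers all constants, including `k` and `n₀`, so that one choice of `z` settles
    -- both the speed and `n₀ ≤ n`.
    a₀ = suc (suc (D + D + (D + D) + suc (D + D) + (D + D)))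
    A₀ = suc δ * (c * 2) + suc D * 2
    A₁ = suc A₀ * (D * 2) + 0
    E = A₁ * D + (k + (a₀ + (D + D)) + n₀)
    found = exponential-beats-linear D E (s≤s z≤n)
    z = proj₁ found
    y = 2 ^ z
    x = 2 ^ y
    m = 2 ^ x
    n = Heap.size δ m
    B = (x + δ) * c + suc D
    B₁ = (y + A₀) * D
    q = suc (B₁ * 2) ^ D

    n≤2^ : n ≤ 2 ^ (x + δ)
    n≤2^ = begin
      suc (m * δ)      ≤⟨ ℕ.+-monoˡ-≤ (m * δ) (1≤2^n x) ⟩
      m + m * δ        ≡⟨ sym (ℕ.*-suc m δ) ⟩
      m * suc δ        ≤⟨ *-≤-2^ x δ ℕ.≤-refl (n<2^n δ) ⟩
      2 ^ (x + δ)      ∎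

    n^c≤ : n ^ c + suc D ≤ 2 ^ B
    n^c≤ = begin
      n ^ c + suc D                        ≤⟨ ℕ.+-monoˡ-≤ (suc D) (^-≤-2^ (x + δ) c n≤2^) ⟩
      2 ^ ((x + δ) * c) + suc D            ≡⟨ ℕ.+-comm _ (suc D) ⟩
      suc D + 2 ^ ((x + δ) * c)            ≤⟨ suc-≤-* (suc D) (1≤2^n ((x + δ) * c)) ⟩
      2 ^ ((x + δ) * c) * suc (suc D)      ≤⟨ *-≤-2^ ((x + δ) * c) (suc D) ℕ.≤-refl (n<2^n (suc D)) ⟩
      2 ^ B                                ∎

    B≤B₁ : suc (B * 2) ^ D ≤ 2 ^ B₁
    B≤B₁ = ^-≤-2^ (y + A₀) D (begin
      suc (B * 2)                          ≡⟨ cong suc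
          (trans (ℕ.*-distribʳ-+ 2 ((x + δ) * c) (suc D)) (cong (_+ suc D * 2) (ℕ.*-assoc (x + δ) c 2))) ⟩
      suc ((x + δ) * (c * 2) + suc D * 2)  ≤⟨ suc-affine-≤-2^ y δ (c * 2) (suc D * 2) ⟩
      2 ^ (y + A₀)                         ∎)

    open LocalAlgorithm c Π cert n B B₁ n^c≤ B≤B₁ using (radius; solves)

    q≤ : q ≤ 2 ^ ((z + A₁) * D)
    q≤ = ^-≤-2^ (z + A₁) D (begin
      suc (B₁ * 2)                         ≡⟨ cong suc
          (trans (ℕ.*-assoc (y + A₀) D 2) (sym (ℕ.+-identityʳ _))) ⟩
      suc ((y + A₀) * (D * 2) + 0)         ≤⟨ suc-affine-≤-2^ z A₀ (D * 2) 0 ⟩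
      2 ^ (z + A₁)                         ∎)

    radius≡ : radius ≡ a₀ + q * (D + D)
    radius≡ = cong (λ w → suc (suc w)) (solve 3 (λ u v w → u :+ (v :+ (v :+ w)) := u :+ (v :+ v) :+ w) refl
                (D + D + (D + D) + suc (D + D)) D (q * (D + D)))
      where open +-*-Solver

    1≤q : 1 ≤ q
    1≤q = ℕ.m^n>0 (suc (B₁ * 2)) D

    radius≤ : radius ≤ 2 ^ ((z + A₁) * D + (a₀ + (D + D)))
    radius≤ = begin
      radius                               ≡⟨ radius≡ ⟩
      a₀ + q * (D + D)                     ≤⟨ ℕ.+-monoˡ-≤ _ (ℕ.m≤n*m a₀ q {{>-nonZero 1≤q}}) ⟩
      q * a₀ + q * (D + D)                 ≡⟨ sym (ℕ.*-distribˡ-+ q a₀ (D + D)) ⟩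
      q * (a₀ + (D + D))                   ≤⟨ *-≤-2^ ((z + A₁) * D) (a₀ + (D + D)) q≤
          (ℕ.<⇒≤ (n<2^n (a₀ + (D + D)))) ⟩
      2 ^ ((z + A₁) * D + (a₀ + (D + D)))  ∎

    exponent : ℕ
    exponent = k + ((z + A₁) * D + (a₀ + (D + D)))

    exponent+n₀<y : exponent + n₀ < y
    exponent+n₀<y = subst (_< y) (solve 6 (λ z d a k r s → z :* d :+ (a :* d :+ (k :+ r :+ s)) := k :+
        ((z :+ a) :* d :+ r) :+ s)
                      refl z D A₁ k (a₀ + (D + D)) n₀) (proj₂ found)
      where open +-*-Solver

    x≤log : x ≤ ⌊log₂ n ⌋
    x≤log = subst (_≤ ⌊log₂ n ⌋) (⌊log₂[2^n]⌋≡n x) (⌊log₂⌋-mono-≤ (ℕ.≤-trans (ℕ.m≤m*n m δ) (ℕ.n≤1+n (m * δ))))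

    kT<log : k * radius < ⌊log₂ n ⌋
    kT<log = begin-strict
      k * radius       ≤⟨ *-≤-2^ k _ (ℕ.<⇒≤ (n<2^n k)) radius≤ ⟩
      2 ^ exponent     <⟨ ℕ.^-monoʳ-< 2 (s≤s (s≤s z≤n)) (ℕ.≤-<-trans (ℕ.m≤m+n exponent n₀) exponent+n₀<y) ⟩
      x                ≤⟨ x≤log ⟩
      ⌊log₂ n ⌋        ∎

    n₀≤n : n₀ ≤ n
    n₀≤n = begin
      n₀               ≤⟨ ℕ.≤-trans (ℕ.m≤n+m n₀ exponent) (ℕ.<⇒≤ exponent+n₀<y) ⟩
      y                ≤⟨ ℕ.<⇒≤ (n<2^n y) ⟩
      x                ≤⟨ ℕ.<⇒≤ (n<2^n x) ⟩
      m                ≤⟨ ℕ.m≤m*n m δ ⟩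
      m * δ            ≤⟨ ℕ.n≤1+n (m * δ) ⟩
      n                ∎

theorem5p4 : (c : ℕ) → 1 ≤ c → (Π : LCL) →
    LocalityΩlog (LCL.δ Π) (SolvesLOCAL c Π) ⇔ LocalityΩlog (LCL.δ Π) (SolvesOnline Π)
theorem5p4 c 1≤c Π = mk⇔ fwd bwd
  where
  fwd : LocalityΩlog (LCL.δ Π) (SolvesLOCAL c Π) → LocalityΩlog (LCL.δ Π) (SolvesOnline Π)
  fwd (k , n₀ , lower) = slope Π + offset Π , 2 ^ offset Π , bound
    where
    bound : ∀ n → 2 ^ offset Π ≤ n → RTree (LCL.δ Π) n → ∀ T → SolvesOnline Π n T → ⌊log₂ n ⌋ ≤
        (slope Π + offset Π) * T
    bound n n≥ tree T solves = ℕ.≮⇒≥ λ fast →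
      -- The certificate comes from the given `n`; the contradiction arises at the unrelated size
      -- `n′`.
      let cert = online⇒certificate Π T n tree (large-enough Π n T n≥ fast) solves
          n′ , n₀≤n′ , tree′ , T′ , solves′ , fast′ = certificate⇒fastLocal c Π cert k n₀
      in ℕ.<⇒≱ fast′ (lower n′ n₀≤n′ tree′ T′ solves′)
  bwd : LocalityΩlog (LCL.δ Π) (SolvesOnline Π) → LocalityΩlog (LCL.δ Π) (SolvesLOCAL c Π)
  bwd (k , n₀ , lower) = k , n₀ , λ n n≥ tree T solves → lower n n≥ tree T (local⇒online c 1≤c Π n T solves)
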